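{- Let $P_5(n)$ be the number of payphone permutations of type (P5) and size $n$. Then $P_5(1) = 1$, $P_5(2) = 2$, $P_5(3) = 4$, and for any integer $n\geq 4$, $$P_5(n) = 2H(S'(n-1)) + H(\{2\}\cup S'(n-2)) + \sum_{i=3}^{n-2} H\big(S'(i-1)\cup S'(n-i)\big),$$ where the function $H$ is defined on the finite multisets $M$ of positive integers by $$H(M) := \bigg(\prod_{k\geq 2} (\#_{2k} M + \#_{2k-1} M)!\bigg) \cdot (\#_2 M)!\cdot (\#_1 M)! \cdot 2^{\sum_{k\geq 1} \#_{2k} M}.$$
   Context: Multisets: $\#_k M$ denotes the multiplicity of $k$ in the multiset $M$, and $\cup$ denotes union of multisets with multiplicities added. For $n\ge 0$, the finite multiset $S(n)$ of positive integers is defined recursively by $S(0)=\emptyset$ and $$S(n)=\{n\}\cup S\left(\left\lfloor\tfrac{n-1}{2}\right\rfloor\right)\cup S\left(\left\lceil\tfrac{n-1}{2}\right\rceil\right)\quad (n\ge 1).$$ Further, $S'(0):=\emptyset$ and $S'(\ell):=S(\ell-1)\cup\{2\ell-1\}$ for $\ell\ge 1$. An empty sum equals $0$. Type (P5) payphone permutations: $n$ payphones, labeled $1,\dots,n$, are arranged in a row; the distance between payphones $i$ and $j$ is $|i-j|$. Persons $1,2,\dots,n$ come one after another and each occupies an available payphone. The first person takes any payphone. Rule (P1) is: a person takes any available payphone such that its closest occupied payphone is as distant as possible. An available payphone is sandwiched if both of its neighbors exist and are occupied. Each person after the first obeys rule (P5): the person follows rule (P1), except that a payphone adjacent to a single occupied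 payphone is preferred to a sandwiched payphone. That is, if some available payphone is at distance at least $2$ from all occupied payphones, the person follows (P1); if every available payphone is adjacent to an occupied one, the person takes any available payphone adjacent to exactly one occupied payphone if there is one (this includes an available end payphone $1$ or $n$ whose only neighbor is occupied), and otherwise takes any (sandwiched) available payphone. The resulting assignment of people to payphones, $(p_1,\dots,p_n)$ with $p_j$ the person occupying payphone $j$, is a payphone permutation of type (P5) and size $n$; $P_5(n)$ counts the distinct permutations of $\{1,\dots,n\}$ that can arise this way. -}

module Defs where

open import Data.Fin.Base as Fin using (Fin; toℕ)
import Data.Fin.Properties as Fin
open import Data.Fin.Subset using (Subset; _∈_; _∉_)
open import Data.Fin.Subset.Properties using (_∈?_)
open import Data.List.Base
  using (List; []; _∷_; [_]; _++_; map; filter; length;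
         applyUpTo; allFin; cartesianProductWith)
import Data.List.Extrema.Nat as Extrema
import Data.List.Membership.Propositional as List
import Data.List.Membership.Propositional.Properties as List
import Data.List.Relation.Unary.All as All
import Data.List.Relation.Unary.AllPairs as ListPairs
open import Data.List.Relation.Unary.Any using (here; there)
import Data.List.Relation.Unary.Unique.Propositional as List
import Data.List.Relation.Unary.Unique.Propositional.Properties as List
open import Data.List.Properties using (filter-none)
open import Data.Nat
open import Data.Nat.ListAction using (sum; product)
open import Data.Nat.Induction using (<-wellFounded)
open import Data.Nat.Properties
open import Data.Product using (_×_; _,_; ∃; ∃!)
open import Data.Sum.Base using (_⊎_)
open import Data.Vec.Base as Vec using (Vec; []; _∷_; lookup)
open import Data.Vec.Properties using (∷-injective)
open import Data.Vec.Relation.Unary.AllPairs using (allPairs?)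
open import Data.Vec.Relation.Unary.Unique.Propositional using (Unique)
open import Induction.WellFounded using (Acc; acc)
open import Relation.Binary.PropositionalEquality
  using (_≡_; refl; cong; cong₂)
open import Relation.Nullary using (Dec; ¬_; does)
open import Relation.Nullary.Decidable
  using (map′; ¬?; _×-dec_; _⊎-dec_; _→-dec_)

-- Payphones and persons are both numbered by Fin n, i.e. shifted to start
-- at 0.  A set O : Subset n is the set of occupied payphones.

module _ {n : ℕ} where

  dist : Fin n → Fin n → ℕ
  dist i j = ∣ toℕ i - toℕ j ∣

  Available : Subset n → Fin n → Set
  Available O j = j ∉ O

  -- Distance from j to the closest occupied payphone.  All distances are
  -- below n, so the default n is returned only when O is empty, a case
  -- that never occurs for persons after the first.
  closest : Subset n → Fin n → ℕ
  closest O j = Extrema.min n (map (dist j) (filter (_∈? O) (allFin n)))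

  P1 : Subset n → Fin n → Set
  P1 O j = Available O j × (∀ i → Available O i → closest O i ≤ closest O j)

  Spacious : Subset n → Fin n → Set
  Spacious O j = Available O j × (∀ i → i ∈ O → 2 ≤ dist i j)

  BesideOne : Subset n → Fin n → Set
  BesideOne O j = Available O j × ∃! _≡_ (λ i → i ∈ O × dist i j ≡ 1)

  Sandwiched : Subset n → Fin n → Set
  Sandwiched O j = Available O j
    × ∃ (λ i → suc (toℕ i) ≡ toℕ j × i ∈ O)
    × ∃ (λ i → toℕ i ≡ suc (toℕ j) × i ∈ O)

  P5 : Subset n → Fin n → Set
  P5 O j =
      (∃ (Spacious O) × P1 O j)
    ⊎ (¬ ∃ (Spacious O) × BesideOne O j)
    ⊎ (¬ ∃ (Spacious O) × ¬ ∃ (BesideOne O) × Sandwiched O j)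

  -- An assignment p lists, for each payphone, the person who occupies it.
  -- When person k arrives, the occupied payphones are those of the persons
  -- smaller than k.
  occupiedBefore : Vec (Fin n) n → Fin n → Subset n
  occupiedBefore p k = Vec.map (λ q → does (q Fin.<? k)) p

  -- n pairwise distinct entries of Fin n form a permutation.  The second
  -- component imposes the rule on every person except the first.
  IsPayphonePermutation₅ : Vec (Fin n) n → Set
  IsPayphonePermutation₅ p = Unique p
    × (∀ j → 0 < toℕ (lookup p j) → P5 (occupiedBefore p (lookup p j)) j)

  available? : ∀ O j → Dec (Available O j)
  available? O j = ¬? (j ∈? O)

  p1? : ∀ O j → Dec (P1 O j)
  p1? O j = available? O j
    ×-dec Fin.all? (λ i → available? O i →-dec closest O i ≤? closest O j)

  spacious? : ∀ O j → Dec (Spacious O j)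
  spacious? O j = available? O j
    ×-dec Fin.all? (λ i → i ∈? O →-dec 2 ≤? dist i j)

  besideOne? : ∀ O j → Dec (BesideOne O j)
  besideOne? O j = available? O j ×-dec Fin.any? (λ i → neighbour? i ×-dec
    map′ (λ f {y} → f y) (λ f y → f {y})
      (Fin.all? (λ y → neighbour? y →-dec i Fin.≟ y)))
    where
    neighbour? : ∀ i → Dec (i ∈ O × dist i j ≡ 1)
    neighbour? i = i ∈? O ×-dec dist i j ≟ 1

  sandwiched? : ∀ O j → Dec (Sandwiched O j)
  sandwiched? O j = available? O j
    ×-dec Fin.any? (λ i → suc (toℕ i) ≟ toℕ j ×-dec i ∈? O)
    ×-dec Fin.any? (λ i → toℕ i ≟ suc (toℕ j) ×-dec i ∈? O)

  p5? : ∀ O j → Dec (P5 O j)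
  p5? O j =
          (Fin.any? (spacious? O) ×-dec p1? O j)
    ⊎-dec (¬? (Fin.any? (spacious? O)) ×-dec besideOne? O j)
    ⊎-dec (¬? (Fin.any? (spacious? O)) ×-dec ¬? (Fin.any? (besideOne? O))
            ×-dec sandwiched? O j)

  isPayphonePermutation₅? : ∀ p → Dec (IsPayphonePermutation₅ p)
  isPayphonePermutation₅? p =
    allPairs? (λ x y → ¬? (x Fin.≟ y)) p
    ×-dec Fin.all? (λ j → 0 <? toℕ (lookup p j)
            →-dec p5? (occupiedBefore p (lookup p j)) j)

vectors : ∀ {A : Set} → List A → (m : ℕ) → List (Vec A m)
vectors xs zero    = [ [] ]
vectors xs (suc m) = cartesianProductWith _∷_ xs (vectors xs m)

assignments : ∀ n → List (Vec (Fin n) n)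
assignments n = vectors (allFin n) n

P₅ : ℕ → ℕ
P₅ n = length (filter isPayphonePermutation₅? (assignments n))

-- Every assignment is listed, and listed once, so P₅ is a cardinality.

∈-assignments : ∀ {n} (p : Vec (Fin n) n) → p List.∈ assignments n
∈-assignments {n} = ∈-vectors
  where
  ∈-vectors : ∀ {m} (v : Vec (Fin n) m) → v List.∈ vectors (allFin n) m
  ∈-vectors []      = here refl
  ∈-vectors (x ∷ v) =
    List.∈-cartesianProductWith⁺ _∷_ (List.∈-allFin x) (∈-vectors v)

assignments-unique : ∀ n → List.Unique (assignments n)
assignments-unique n = vectors-unique n
  where
  vectors-unique : ∀ m → List.Unique (vectors (allFin n) m)
  vectors-unique zero    = All.[] ListPairs.∷ ListPairs.[]
  vectors-unique (suc m) = List.cartesianProductWith⁺ _∷_ ∷-injective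
    (List.allFin⁺ n) (vectors-unique m)

-- Finite multisets are lists considered up to order, so _++_ is the union
-- adding multiplicities.
Multiset : Set
Multiset = List ℕ

mult : ℕ → Multiset → ℕ
mult k M = length (filter (k ≟_) M)

-- The recursion for n = suc m calls ⌊ m /2⌋ and ⌈ m /2⌉; see S-suc.
S-acc : ∀ n → Acc _<_ n → Multiset
S-acc zero    _        = []
S-acc (suc m) (acc rs) = [ suc m ]
  ++ S-acc ⌊ m /2⌋ (rs (s≤s (⌊n/2⌋≤n m)))
  ++ S-acc ⌈ m /2⌉ (rs (s≤s (⌈n/2⌉≤n m)))

S : ℕ → Multiset
S n = S-acc n (<-wellFounded n)

S-acc-irrelevant : ∀ n (a b : Acc _<_ n) → S-acc n a ≡ S-acc n b
S-acc-irrelevant zero    _       _       = refl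
S-acc-irrelevant (suc m) (acc r) (acc s) = cong ([ suc m ] ++_)
  (cong₂ _++_ (S-acc-irrelevant ⌊ m /2⌋ _ _) (S-acc-irrelevant ⌈ m /2⌉ _ _))

S-suc : ∀ m → S (suc m) ≡ [ suc m ] ++ S ⌊ m /2⌋ ++ S ⌈ m /2⌉
S-suc m with <-wellFounded (suc m)
... | acc _ = cong ([ suc m ] ++_)
  (cong₂ _++_ (S-acc-irrelevant ⌊ m /2⌋ _ _) (S-acc-irrelevant ⌈ m /2⌉ _ _))

S′ : ℕ → Multiset
S′ zero    = []
S′ (suc l) = S l ++ [ 2 * suc l ∸ 1 ]

-- The integers a, a + 1, …, b; empty when b < a.
[_⋯_] : ℕ → ℕ → List ℕ
[ a ⋯ b ] = applyUpTo (a +_) (suc b ∸ a)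

∑ ∏ : List ℕ → (ℕ → ℕ) → ℕ
∑ ks f = sum (map f ks)
∏ ks f = product (map f ks)

maximum : Multiset → ℕ
maximum M = Extrema.max 0 M

-- The product and the sum run over all k in the mathematical definition.
-- They are cut off at k = maximum M: for larger k, 2k and 2k - 1 exceed
-- every element of M and the multiplicities vanish (mult-beyond).
H : Multiset → ℕ
H M = ∏ [ 2 ⋯ maximum M ] (λ k → (mult (2 * k) M + mult (2 * k ∸ 1) M) !)
    * (mult 2 M) !
    * (mult 1 M) !
    * 2 ^ ∑ [ 1 ⋯ maximum M ] (λ k → mult (2 * k) M)

mult-beyond : ∀ {k} M → maximum M < k → mult k M ≡ 0
mult-beyond {k} M max<k = cong length (filter-none (k ≟_)
  (All.map (λ { x≤max refl → <⇒≱ max<k x≤max }) (Extrema.xs≤max 0 M)))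

{-# OPTIONS --safe #-}
-- A state is described by the gaps of free payphones between, left of and
-- right of the occupied ones.  A gap offers its payphones farthest from the
-- occupied ones in a phase that depends only on its kind and length, and
-- filling it leaves two gaps of lower phases.  So all gaps that ever arise
-- form a multiset fixed by the current state, the phases come in decreasing
-- order, and within a phase every order and every choice of payphones is
-- possible: the number of completions is the product of (number of gaps of
-- phase r)! over all r, times 2 for each gap of even length between two
-- occupied payphones.  This is H, except for an end gap of length 1: it has
-- the phase of a gap of length 2 but no choice, so the first persons at 2 and
-- at n - 1 together account for the single term H({2} ∪ S′(n - 2)).
module Submission where

open import Defs
open import Algebra.Properties.CommutativeSemigroup using (interchange)
open import Data.Empty using (⊥)
open import Data.Fin.Base as Fin using (Fin; toℕ; fromℕ<)
import Data.Fin.Properties as Fin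
open import Data.Fin.Subset using (Subset) renaming (_∈_ to _∈ₛ_)
open import Data.Fin.Subset.Properties using () renaming (_∈?_ to _∈ₛ?_)
open import Data.List.Base as List
  using (List; []; _∷_; [_]; _++_; _∷ʳ_; map; filter; length; allFin; concatMap; applyUpTo; upTo; tabulate)
import Data.List.Extrema.Nat as Extrema
open import Data.List.Membership.Propositional using (_∈_; _∉_; lose; find)
open import Data.List.Membership.Propositional.Properties
  using (∈-allFin; ∈-lookup; ∈-filter⁺; ∈-filter⁻; ∈-map⁺; ∈-map⁻; ∈-++⁺ˡ; ∈-++⁺ʳ; ∈-∃++;
         ∈-concatMap⁺; ∈-concatMap⁻; ∈-applyUpTo⁺; ∈-applyUpTo⁻)
open import Data.List.Membership.Propositional.Properties.WithK using (unique∧set⇒bag)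
open import Data.List.Properties
  using (filter-none; filter-accept; filter-reject; filter-≐; filter-++; length-++; length-map;
         ++-identityʳ; map-++; map-cong; map-cong-local; map-∘; map-applyUpTo; map-tabulate;
         concatMap-++; applyUpTo-∷ʳ)
open import Data.List.Relation.Binary.BagAndSetEquality using (∼bag⇒↭)
open import Data.List.Relation.Binary.Disjoint.Propositional using (Disjoint)
open import Data.List.Relation.Binary.Permutation.Propositional as Perm
  using (_↭_; ↭-refl; ↭-sym; ↭-trans; ↭-reflexive; ↭-prep; ↭⇒↭ₛ)
import Data.List.Relation.Binary.Permutation.Propositional.Properties as Perm
open import Data.List.Relation.Binary.Permutation.Setoid.Properties using (AllPairs-resp-↭)
open import Data.List.Relation.Unary.All as All using (All; []; _∷_)
import Data.List.Relation.Unary.All.Properties as All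
open import Data.List.Relation.Unary.AllPairs as AllPairs using (AllPairs; []; _∷_)
import Data.List.Relation.Unary.AllPairs.Properties as AllPairs
open import Data.List.Relation.Unary.Any using (here; there)
open import Data.List.Relation.Unary.Unique.Propositional using (Unique)
import Data.List.Relation.Unary.Unique.Propositional.Properties as Unique
open import Data.Nat.Base
open import Data.Nat.Induction using (<-wellFounded)
open import Data.Nat.ListAction using (sum; product)
open import Data.Nat.ListAction.Properties using (sum-++; sum-↭)
open import Data.Nat.Properties
open import Data.List.Extrema ≤-totalOrder using (min≤v⁺; v≤min⁺)
open import Data.Nat.Tactic.RingSolver using (solve-∀)
open import Data.Product using (∃; ∃!; _×_; _,_; proj₁; proj₂)
open import Data.Sum.Base using (_⊎_; inj₁; inj₂)
open import Data.Unit.Base using (⊤; tt)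
open import Data.Vec.Base as Vec using (Vec; lookup; _[_]≔_)
import Data.Vec.Properties as Vec
open import Data.Vec.Relation.Binary.Pointwise.Extensional using (ext; Pointwise-≡⇒≡)
import Data.Vec.Relation.Unary.Unique.Propositional as VecUnique
import Data.Vec.Relation.Unary.Unique.Propositional.Properties as VecUnique
open import Function.Base using (_∘_; id)
open import Function.Bundles using (mk⇔)
open import Function.Definitions using (Injective)
open import Induction.WellFounded using (Acc; acc)
open import Relation.Binary.Definitions using (tri<; tri≈; tri>)
open import Relation.Binary.PropositionalEquality hiding ([_])
open import Relation.Nullary using (Dec; yes; no; does; ¬_; contradiction)
open import Relation.Nullary.Decidable using (_×-dec_; does-⇔; dec-true)

-- The obstacle is the step from one state to the next: gaps of one phase may offer different
-- numbers of payphones, so the states reachable in one step may have different weights. Taking a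
-- payphone from a gap with item `(r , c)` divides the weight by `c` and by the number `m` of gaps
-- of phase `r`. Summed over the `c` payphones of that gap this gives the share `1 / m`, the same
-- for each of the `m` gaps, and the shares add up to the whole weight. Division is avoided by
-- multiplying both sides by `m`. The label `2l - 1` in `S′ l` has this origin: in an end gap of
-- length `l` the far end is taken, at distance `l` and without alternative, which leaves `l - 1`
-- payphones between two occupied ones. A middle gap of length `2l - 1` has the same phase and also
-- a single choice as soon as `l ≥ 2`. For `l = 1` it is the label 1, which comes last, whereas the
-- end payphone is preferred to every sandwiched one.

-- Sums and cardinalities

sum-map-+ : ∀ {A : Set} (f g : A → ℕ) xs →
  sum (map (λ x → f x + g x) xs) ≡ sum (map f xs) + sum (map g xs)
sum-map-+ f g []       = refl
sum-map-+ f g (x ∷ xs) =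
  trans (cong (f x + g x +_) (sum-map-+ f g xs)) (interchange +-commutativeSemigroup (f x) (g x) _ _)

sum-map-const : ∀ {A : Set} {f : A → ℕ} {c xs} → All (λ x → f x ≡ c) xs →
  sum (map f xs) ≡ length xs * c
sum-map-const []       = refl
sum-map-const (e ∷ es) = cong₂ _+_ e (sum-map-const es)

indicator : ∀ {P : Set} → Dec P → ℕ
indicator (yes _) = 1
indicator (no  _) = 0

module _ {A : Set} where

  length-filter-∷ : ∀ {P : A → Set} (P? : ∀ x → Dec (P x)) x xs →
    length (filter P? (x ∷ xs)) ≡ indicator (P? x) + length (filter P? xs)
  length-filter-∷ P? x xs with P? x
  ... | yes _ = refl
  ... | no  _ = refl

  sum-map-indicator : ∀ {P : A → Set} (P? : ∀ x → Dec (P x)) xs →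
    sum (map (indicator ∘ P?) xs) ≡ length (filter P? xs)
  sum-map-indicator P? []       = refl
  sum-map-indicator P? (x ∷ xs) =
    trans (cong (indicator (P? x) +_) (sum-map-indicator P? xs))
          (sym (length-filter-∷ P? x xs))

  length-filter-∃! : ∀ {P : A → Set} (P? : ∀ x → Dec (P x)) {x xs} →
    Unique xs → x ∈ xs → P x → (∀ y → P y → y ≡ x) → length (filter P? xs) ≡ 1
  length-filter-∃! P? {xs = x ∷ xs} (x∉ ∷ _) (here refl) Px x! =
    trans (cong length (filter-accept P? Px))
      (cong (suc ∘ length)
        (filter-none P? (All.map (λ x≢y Py → x≢y (sym (x! _ Py))) x∉)))
  length-filter-∃! P? {xs = y ∷ xs} (y∉ ∷ u) (there x∈) Px x! =
    trans (cong length (filter-reject P? λ Py → All.lookup y∉ x∈ (x! _ Py)))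
      (length-filter-∃! P? u x∈ Px x!)

module _ {A : Set} where

  -- Both sides count the pairs `(i , x)` with `Q i x`, one `x` at a time: there is exactly one such
  -- `i` if `P x` holds, and none otherwise.
  length-filter-partition : ∀ {I : Set} {P : A → Set} {Q : I → A → Set}
    (P? : ∀ x → Dec (P x)) (Q? : ∀ i x → Dec (Q i x)) {is} → Unique is →
    (∀ {x} → P x → ∃ λ i → i ∈ is × Q i x) →
    (∀ {i x} → Q i x → P x) →
    (∀ {i j x} → Q i x → Q j x → i ≡ j) → ∀ xs →
    length (filter P? xs) ≡ sum (map (λ i → length (filter (Q? i) xs)) is)
  length-filter-partition {I} {P} {Q} P? Q? {is} u cover sound disjoint = go
    where
    open ≡-Reasoning

    pointwise : ∀ x → indicator (P? x) ≡ length (filter (λ i → Q? i x) is)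
    pointwise x with P? x
    ... | yes Px with i , i∈ , Qix ← cover Px =
      sym (length-filter-∃! (λ i → Q? i x) u i∈ Qix λ j Qjx → disjoint Qjx Qix)
    ... | no ¬Px =
      sym (cong length (filter-none (λ i → Q? i x) (All.universal (λ i Qix → ¬Px (sound Qix)) is)))

    go : ∀ xs → length (filter P? xs) ≡ sum (map (λ i → length (filter (Q? i) xs)) is)
    go [] = sym (trans (sum-map-const (All.universal (λ _ → refl) is)) (*-zeroʳ (length is)))
    go (x ∷ xs) = begin
      length (filter P? (x ∷ xs))
        ≡⟨ length-filter-∷ P? x xs ⟩
      indicator (P? x) + length (filter P? xs)
        ≡⟨ cong₂ _+_ (pointwise x) (go xs) ⟩
      length (filter (λ i → Q? i x) is) + sum (map (λ i → length (filter (Q? i) xs)) is)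
        ≡⟨ cong (_+ _) (sum-map-indicator (λ i → Q? i x) is) ⟨
      sum (map (λ i → indicator (Q? i x)) is) + sum (map (λ i → length (filter (Q? i) xs)) is)
        ≡⟨ sum-map-+ (λ i → indicator (Q? i x)) _ is ⟨
      sum (map (λ i → indicator (Q? i x) + length (filter (Q? i) xs)) is)
        ≡⟨ cong sum (map-cong (λ i → sym (length-filter-∷ (Q? i) x xs)) is) ⟩
      sum (map (λ i → length (filter (Q? i) (x ∷ xs))) is) ∎

-- Finite pigeonhole principles

-- A missed value could be punched out of the codomain, leaving an injection into a smaller set.
injective⇒surjective : ∀ {n} {f : Fin n → Fin n} → Injective _≡_ _≡_ f → ∀ y → ∃ λ x → f x ≡ y
injective⇒surjective {suc n} {f} inj y with Fin.any? (λ x → f x Fin.≟ y)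
... | yes p = p
... | no ¬p = contradiction
  (Fin.injective⇒≤ λ {i} {j} → inj ∘ Fin.punchOut-injective (avoid i) (avoid j)) 1+n≰n
  where
  avoid : ∀ x → y ≢ f x
  avoid x y≡fx = ¬p (x , sym y≡fx)

lookup-injective : ∀ {A : Set} {xs : List A} → Unique xs → Injective _≡_ _≡_ (List.lookup xs)
lookup-injective (_  ∷ _) {Fin.zero}  {Fin.zero}  _  = refl
lookup-injective (x∉ ∷ _) {Fin.zero}  {Fin.suc j} eq = contradiction eq (All.lookup x∉ (∈-lookup j))
lookup-injective (x∉ ∷ _) {Fin.suc i} {Fin.zero}  eq = contradiction (sym eq) (All.lookup x∉ (∈-lookup i))
lookup-injective (_  ∷ u) {Fin.suc i} {Fin.suc j} eq = cong Fin.suc (lookup-injective u eq)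

-- Permutations extending a partial one

module _ {n : ℕ} where

  open import Data.List.Membership.DecPropositional (Fin._≟_ {n}) using (_∈?_)

  -- In Placed p js and below, js lists the positions of the persons
  -- length js ∸ 1, …, 1, 0, in this order.
  Placed : Vec (Fin n) n → List (Fin n) → Set
  Placed p []       = ⊤
  Placed p (j ∷ js) = toℕ (lookup p j) ≡ length js × Placed p js

  placed? : ∀ p js → Dec (Placed p js)
  placed? p []       = yes tt
  placed? p (j ∷ js) = toℕ (lookup p j) ≟ length js ×-dec placed? p js

  Extends : List (Fin n) → Vec (Fin n) n → Set
  Extends js p = IsPayphonePermutation₅ p × Placed p js

  extends? : ∀ js p → Dec (Extends js p)
  extends? js p = isPayphonePermutation₅? p ×-dec placed? p js

  extensions : List (Fin n) → ℕ
  extensions js = length (filter (extends? js) (assignments n))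

  occupied : List (Fin n) → Subset n
  occupied js = Vec.tabulate (λ i → does (i ∈? js))

  ∈-occupied⁺ : ∀ {i js} → i ∈ js → i ∈ₛ occupied js
  ∈-occupied⁺ {i} {js} i∈ =
    Vec.lookup⇒[]= i _ (trans (Vec.lookup∘tabulate _ i) (dec-true (i ∈? js) i∈))

  ∈-occupied⁻ : ∀ {i js} → i ∈ₛ occupied js → i ∈ js
  ∈-occupied⁻ {i} {js} i∈
    with i ∈? js | trans (sym (Vec.lookup∘tabulate (λ i → does (i ∈? js)) i)) (Vec.[]=⇒lookup i∈)
  ... | yes p | _  = p
  ... | no _  | ()

  private
    variable
      p p′ : Vec (Fin n) n
      i j : Fin n
      js : List (Fin n)

  placed-< : Placed p js → i ∈ js → toℕ (lookup p i) < length js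
  placed-< (eq , _)  (here refl) = s≤s (≤-reflexive eq)
  placed-< (_  , pl) (there i∈)  = m≤n⇒m≤1+n (placed-< pl i∈)

  placed-injective : Placed p js → i ∈ js → j ∈ js → lookup p i ≡ lookup p j → i ≡ j
  placed-injective _ (here refl) (here refl) _ = refl
  placed-injective (eq , pl) (here refl) (there j∈) e =
    contradiction (trans (sym (cong toℕ e)) eq) (<⇒≢ (placed-< pl j∈))
  placed-injective (eq , pl) (there i∈) (here refl) e =
    contradiction (trans (cong toℕ e) eq) (<⇒≢ (placed-< pl i∈))
  placed-injective (_ , pl) (there i∈) (there j∈) e = placed-injective pl i∈ j∈ e

  placed-∈ : Injective _≡_ _≡_ (lookup p) → Placed p js → toℕ (lookup p i) < length js → i ∈ js
  placed-∈ {p} {j ∷ js} {i} inj (eq , pl) (s≤s i≤) with m≤n⇒m<n∨m≡n i≤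
  ... | inj₁ i<   = there (placed-∈ inj pl i<)
  ... | inj₂ i≡   = here (inj (Fin.toℕ-injective (trans i≡ (sym eq))))

  placed-agree : Placed p js → Placed p′ js → i ∈ js → lookup p i ≡ lookup p′ i
  placed-agree (eq , _)  (eq′ , _)   (here refl) = Fin.toℕ-injective (trans eq (sym eq′))
  placed-agree (_  , pl) (_   , pl′) (there i∈)  = placed-agree pl pl′ i∈

  -- This turns the rule, stated for a whole permutation, into a condition on the list of payphones
  -- taken so far.
  occupiedBefore≡occupied : ∀ {k} → Injective _≡_ _≡_ (lookup p) → Placed p js →
    toℕ k ≡ length js → occupiedBefore p k ≡ occupied js
  occupiedBefore≡occupied {p} {js} {k} inj pl k≡ = Pointwise-≡⇒≡ (ext λ i → begin
    lookup (occupiedBefore p k) i   ≡⟨ Vec.lookup-map i _ p ⟩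
    does (lookup p i Fin.<? k)      ≡⟨ does-⇔ (mk⇔ (to i) (from i)) (lookup p i Fin.<? k) (i ∈? js) ⟩
    does (i ∈? js)                  ≡⟨ Vec.lookup∘tabulate _ i ⟨
    lookup (occupied js) i          ∎)
    where
    open ≡-Reasoning
    to : ∀ i → lookup p i Fin.< k → i ∈ js
    to i lt = placed-∈ inj pl (subst (toℕ (lookup p i) <_) k≡ lt)
    from : ∀ i → i ∈ js → lookup p i Fin.< k
    from i i∈ = subst (toℕ (lookup p i) <_) (sym k≡) (placed-< pl i∈)

  unique⇒injective : VecUnique.Unique p → Injective _≡_ _≡_ (lookup p)
  unique⇒injective u = VecUnique.lookup-injective u _ _

  injective⇒unique : Injective _≡_ _≡_ (lookup p) → VecUnique.Unique p
  injective⇒unique {p} inj = subst VecUnique.Unique (Vec.tabulate∘lookup p) (VecUnique.tabulate⁺ inj)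

  available⇒∉ : Available (occupied js) j → j ∉ js
  available⇒∉ av = av ∘ ∈-occupied⁺

  ∉⇒available : j ∉ js → Available (occupied js) j
  ∉⇒available j∉ = j∉ ∘ ∈-occupied⁻

  P5⇒Available : ∀ {O : Subset n} → P5 O j → Available O j
  P5⇒Available (inj₁ (_ , av , _))              = av
  P5⇒Available (inj₂ (inj₁ (_ , av , _)))       = av
  P5⇒Available (inj₂ (inj₂ (_ , _ , av , _)))   = av

  extension-next : Extends js p → i ∉ js → ∃ λ j → Extends (j ∷ js) p
  extension-next {js} {p} {i} (legal@(u , _) , pl) i∉ =
    proj₁ placed-next , legal , trans (cong toℕ (proj₂ placed-next)) (Fin.toℕ-fromℕ< k<n) , pl
    where
    inj = unique⇒injective u
    k<n : length js < n
    -- The person at the free payphone `i` is none of the placed ones, so its number is at least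
    -- `length js`.
    k<n = ≤-<-trans (≮⇒≥ (i∉ ∘ placed-∈ inj pl)) (Fin.toℕ<n (lookup p i))
    placed-next = injective⇒surjective inj (fromℕ< k<n)

  extension-P5 : 0 < length js → Extends (j ∷ js) p → P5 (occupied js) j
  extension-P5 {js} {j} {p} 0<k ((u , rule) , eq , pl) =
    subst (λ O → P5 O j) (occupiedBefore≡occupied (unique⇒injective u) pl eq)
      (rule j (subst (0 <_) (sym eq) 0<k))

  -- The list `is` need only contain every payphone that the next person can take; other entries
  -- contribute 0. So the same step serves the first person, who is free to choose, and all later
  -- ones.
  extensions-step : ∀ {is} → Unique is → i ∉ js →
    (∀ {j p} → Extends (j ∷ js) p → j ∈ is) →
    extensions js ≡ sum (map (λ j → extensions (j ∷ js)) is)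
  extensions-step {js = js} u i∉ all =
    length-filter-partition (extends? js) (λ j → extends? (j ∷ js)) u
      (λ e → let j , e′ = extension-next e i∉ in j , all e′ , e′)
      (λ (legal , _ , pl) → legal , pl)
      (λ ((u , _) , eq , _) (_ , eq′ , _) →
        unique⇒injective u (Fin.toℕ-injective (trans eq (sym eq′))))
      (assignments n)

  -- `Extends` speaks of finished permutations. That a full list has an extension at all requires a
  -- record that each of its steps was legal; the first person is exempt, hence the base case.
  data Chain : List (Fin n) → Set where
    start : ∀ j → Chain [ j ]
    next  : P5 (occupied js) j → Chain js → Chain (j ∷ js)

  chain-unique : Chain js → Unique js
  chain-unique (start j)   = [] ∷ []
  chain-unique (next p5 c) = All.¬Any⇒All¬ _ (available⇒∉ (P5⇒Available p5)) ∷ chain-unique c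

  chain-rule : Injective _≡_ _≡_ (lookup p) → Placed p js → Chain js → i ∈ js →
    0 < toℕ (lookup p i) → P5 (occupiedBefore p (lookup p i)) i
  chain-rule inj (eq , _) (start j) (here refl) 0<p = contradiction eq (>⇒≢ 0<p)
  chain-rule {i = i} inj (eq , pl) (next p5 c) (here refl) _ =
    subst (λ O → P5 O i) (sym (occupiedBefore≡occupied inj pl eq)) p5
  chain-rule inj (_ , pl) (next _ c) (there i∈) 0<p = chain-rule inj pl c i∈ 0<p

  placed-update : ∀ {k} → j ∉ js → Placed p js → Placed (p [ j ]≔ k) js
  placed-update {js = []} _ _ = tt
  placed-update {j} {i ∷ js} {p} j∉ (eq , pl) =
    trans (cong toℕ (Vec.lookup∘update′ (j∉ ∘ here ∘ sym) p _)) eq ,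
    placed-update (j∉ ∘ there) pl

  unique⇒placed : Unique js → ∃ λ p → Placed p js
  -- An arbitrary vector to start from: only its entries at `js` get prescribed values, by updates.
  unique⇒placed {[]} _ = Vec.allFin n , tt
  unique⇒placed {j ∷ js} u@(_ ∷ u′) with p , pl ← unique⇒placed u′ =
    p [ j ]≔ k ,
    trans (cong toℕ (Vec.lookup∘update j p k)) (Fin.toℕ-fromℕ< _) ,
    placed-update (Unique.Unique[x∷xs]⇒x∉xs u) pl
    where k = fromℕ< {length js} (Fin.injective⇒≤ (lookup-injective u))

  extensions-complete : Chain js → (∀ i → i ∈ js) → extensions js ≡ 1
  extensions-complete {js} c all with p , pl ← unique⇒placed (chain-unique c) =
    length-filter-∃! (extends? js) (assignments-unique n) (∈-assignments p) extends
      (λ p′ (_ , pl′) → Pointwise-≡⇒≡ (ext λ i → placed-agree pl′ pl (all i)))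
    where
    inj : Injective _≡_ _≡_ (lookup p)
    inj = placed-injective pl (all _) (all _)
    extends : Extends js p
    extends = (injective⇒unique inj , λ j → chain-rule inj pl c (all j)) , pl

-- The weight of a multiset of items

-- An item (r , c) stands for a gap that is filled in phase r, with c choices
-- for the payphone taken in it.
Item : Set
Item = ℕ × ℕ

count : ℕ → List Item → ℕ
count r xs = length (filter (λ x → r ≟ proj₁ x) xs)

-- Equals the product of (count r xs) ! over all r and of all c in xs.
weight : List Item → ℕ
weight []             = 1
weight ((r , c) ∷ xs) = c * (suc (count r xs) * weight xs)

count-↭ : ∀ r {xs ys} → xs ↭ ys → count r xs ≡ count r ys
count-↭ r p = Perm.↭-length (Perm.filter-↭ (λ x → r ≟ proj₁ x) p)

count-++ : ∀ r xs ys → count r (xs ++ ys) ≡ count r xs + count r ys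
count-++ r xs ys = trans (cong length (filter-++ (λ x → r ≟ proj₁ x) xs ys))
  (length-++ (filter (λ x → r ≟ proj₁ x) xs))

count-accept : ∀ r c xs → count r ((r , c) ∷ xs) ≡ suc (count r xs)
count-accept r c xs = cong length (filter-accept (λ x → r ≟ proj₁ x) refl)

count-reject : ∀ {r s} c xs → r ≢ s → count r ((s , c) ∷ xs) ≡ count r xs
count-reject {r} c xs r≢s = cong length (filter-reject (λ x → r ≟ proj₁ x) r≢s)

count-none : ∀ {r xs} → All (λ x → proj₁ x < r) xs → count r xs ≡ 0
count-none {r} a = cong length
  (filter-none (λ x → r ≟ proj₁ x) (All.map (λ lt eq → <⇒≢ lt (sym eq)) a))

-- In the same phase, the factors `suc (suc k)` and `suc k` arise in either order; in different
-- phases neither item enters the count of the other.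
weight-swap : ∀ x y xs → weight (x ∷ y ∷ xs) ≡ weight (y ∷ x ∷ xs)
weight-swap (r , c) (s , d) xs with r ≟ s
... | yes refl = begin
  c * (suc (count r ((r , d) ∷ xs)) * (d * (suc k * w)))
    ≡⟨ cong (λ h → c * (suc h * (d * (suc k * w)))) (count-accept r d xs) ⟩
  c * (suc (suc k) * (d * (suc k * w)))
    ≡⟨ rearrange c d (suc (suc k)) (suc k) w ⟩
  d * (suc (suc k) * (c * (suc k * w)))
    ≡⟨ cong (λ h → d * (suc h * (c * (suc k * w)))) (count-accept r c xs) ⟨
  d * (suc (count r ((r , c) ∷ xs)) * (c * (suc k * w))) ∎
  where
  open ≡-Reasoning
  k = count r xs
  w = weight xs
  rearrange : ∀ c d k l w → c * (k * (d * (l * w))) ≡ d * (k * (c * (l * w)))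
  rearrange = solve-∀
... | no r≢s = begin
  c * (suc (count r ((s , d) ∷ xs)) * (d * (suc l * w)))
    ≡⟨ cong (λ h → c * (suc h * (d * (suc l * w)))) (count-reject d xs r≢s) ⟩
  c * (suc k * (d * (suc l * w)))
    ≡⟨ rearrange c d (suc k) (suc l) w ⟩
  d * (suc l * (c * (suc k * w)))
    ≡⟨ cong (λ h → d * (suc h * (c * (suc k * w)))) (count-reject c xs (r≢s ∘ sym)) ⟨
  d * (suc (count s ((r , c) ∷ xs)) * (c * (suc k * w))) ∎
  where
  open ≡-Reasoning
  k = count r xs
  l = count s xs
  w = weight xs
  rearrange : ∀ c d k l w → c * (k * (d * (l * w))) ≡ d * (l * (c * (k * w)))
  rearrange = solve-∀

weight-∷ : ∀ x {xs ys} → xs ↭ ys → weight xs ≡ weight ys → weight (x ∷ xs) ≡ weight (x ∷ ys)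
weight-∷ (r , c) p e = cong (c *_) (cong₂ (λ k w → suc k * w) (count-↭ r p) e)

weight-↭ : ∀ {xs ys} → xs ↭ ys → weight xs ≡ weight ys
weight-↭ Perm.refl         = refl
weight-↭ (Perm.prep x p)        = weight-∷ x p (weight-↭ p)
weight-↭ (Perm.swap x y p)      = trans (weight-swap x y _)
  (weight-∷ y (Perm.prep x p) (weight-∷ x p (weight-↭ p)))
weight-↭ (Perm.trans p q)  = trans (weight-↭ p) (weight-↭ q)

-- Labels and gaps

-- Parity of `m` in the form needed here: the `m` payphones left of a gap of `suc m` fall into equal
-- parts, so the gap has a single middle.
Balanced : ℕ → Set
Balanced m = ⌊ m /2⌋ ≡ ⌈ m /2⌉

balanced? : ∀ m → Dec (Balanced m)
balanced? m = ⌊ m /2⌋ ≟ ⌈ m /2⌉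

-- The phase in which a gap of l payphones between two occupied ones is
-- filled: the distance ⌈ l /2⌉ from its middle to its ends, except that the
-- sandwiched payphone of a gap with l = 1 comes last.
phase : ℕ → ℕ
phase 0             = 0
phase 1             = 0
phase (suc (suc m)) = suc ⌊ suc m /2⌋

choices : ℕ → ℕ
choices zero    = 1
choices (suc m) with balanced? m
... | yes _ = 1
... | no  _ = 2

item : ℕ → Item
item l = phase l , choices l

items : ℕ → List Item
items l = map item (S l)

-- The payphone taken is the one at the end of the row, at distance `suc e` from the only wall; the
-- other `e` become a middle gap.
endItems : ℕ → List Item
endItems zero    = []
endItems (suc e) = (suc e , 1) ∷ items e

items-suc : ∀ m → items (suc m) ≡ item (suc m) ∷ items ⌊ m /2⌋ ++ items ⌈ m /2⌉
items-suc m = trans (cong (map item) (S-suc m))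
  (cong (item (suc m) ∷_) (map-++ item (S ⌊ m /2⌋) (S ⌈ m /2⌉)))

phase-mono : ∀ {k l} → k ≤ l → phase k ≤ phase l
phase-mono {0}           _                = z≤n
phase-mono {1}           _                = z≤n
phase-mono {suc (suc k)} (s≤s (s≤s k≤l)) = s≤s (⌊n/2⌋-mono (s≤s k≤l))

phase≤ : ∀ l → phase l ≤ l
phase≤ 0             = z≤n
phase≤ 1             = z≤n
phase≤ (suc (suc m)) = s≤s (⌊n/2⌋≤n (suc m))

phase-suc : ∀ l → phase (suc l) ≤ l
phase-suc zero    = z≤n
phase-suc (suc k) = ⌊n/2⌋<n k

-- Dividing a gap of `2 + m` leaves at most `⌈ suc m /2⌉` on a side, and the bound is one below
-- `phase (2 + m)`: this is why phases strictly decrease.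
phase-half : ∀ m → phase ⌈ suc m /2⌉ ≤ ⌊ suc m /2⌋
phase-half m = ≤-trans (phase-suc ⌊ m /2⌋) (⌊n/2⌋-mono (n≤1+n m))

S-≤ : ∀ n → All (_≤ n) (S n)
S-≤ n = go n (<-wellFounded n)
  where
  go : ∀ n (a : Acc _<_ n) → All (_≤ n) (S-acc n a)
  go zero    _        = []
  go (suc m) (acc rs) = ≤-refl ∷ All.++⁺
    (All.map (λ k≤ → ≤-trans k≤ (≤-trans (⌊n/2⌋≤n m) (n≤1+n m))) (go ⌊ m /2⌋ _))
    (All.map (λ k≤ → ≤-trans k≤ (≤-trans (⌈n/2⌉≤n m) (n≤1+n m))) (go ⌈ m /2⌉ _))

items-phase : ∀ l → All (λ x → proj₁ x ≤ phase l) (items l)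
items-phase l = All.map⁺ (All.map phase-mono (S-≤ l))

-- The payphones at which a gap is filled

topOffsets : ℕ → List ℕ
topOffsets m with balanced? m
... | yes _ = [ ⌊ m /2⌋ ]
... | no  _ = ⌊ m /2⌋ ∷ [ ⌈ m /2⌉ ]

-- Both orders are allowed because the two middles of an even gap leave mirror images, with the same
-- items.
Halves : ℕ → ℕ → ℕ → Set
Halves m u v = (u ≡ ⌊ m /2⌋ × v ≡ ⌈ m /2⌉) ⊎ (u ≡ ⌈ m /2⌉ × v ≡ ⌊ m /2⌋)

length-topOffsets : ∀ m → length (topOffsets m) ≡ choices (suc m)
length-topOffsets m with balanced? m
... | yes _ = refl
... | no  _ = refl

topOffsets-unique : ∀ m → Unique (topOffsets m)
topOffsets-unique m with balanced? m
... | yes _ = [] ∷ []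
... | no ne = (ne ∷ []) ∷ [] ∷ []

complement-⌊⌋ : ∀ {u v} → u ≡ ⌊ u + v /2⌋ → v ≡ ⌈ u + v /2⌉
complement-⌊⌋ {u} {v} eq = +-cancelˡ-≡ u _ _
  (trans (sym (⌊n/2⌋+⌈n/2⌉≡n (u + v))) (cong (_+ ⌈ u + v /2⌉) (sym eq)))

topOffsets-halves : ∀ {m u} → u ∈ topOffsets m → ∃ λ v → u + v ≡ m × Halves m u v
topOffsets-halves {m} {u} u∈ with balanced? m
topOffsets-halves {m} (here refl)         | yes _ = ⌈ m /2⌉ , ⌊n/2⌋+⌈n/2⌉≡n m , inj₁ (refl , refl)
topOffsets-halves {m} (here refl)         | no  _ = ⌈ m /2⌉ , ⌊n/2⌋+⌈n/2⌉≡n m , inj₁ (refl , refl)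
topOffsets-halves {m} (there (here refl)) | no  _ =
  ⌊ m /2⌋ , trans (+-comm ⌈ m /2⌉ _) (⌊n/2⌋+⌈n/2⌉≡n m) , inj₂ (refl , refl)

∈-topOffsets⁺ : ∀ {u v} → Halves (u + v) u v → u ∈ topOffsets (u + v)
∈-topOffsets⁺ {u} {v} h with balanced? (u + v)
∈-topOffsets⁺ (inj₁ (eq , _)) | yes _ = here eq
∈-topOffsets⁺ (inj₂ (eq , _)) | yes e = here (trans eq (sym e))
∈-topOffsets⁺ (inj₁ (eq , _)) | no _  = here eq
∈-topOffsets⁺ (inj₂ (eq , _)) | no _  = there (here eq)

u≤v⇒u≤half : ∀ {u v} → u ≤ v → u ≤ ⌊ u + v /2⌋
u≤v⇒u≤half {u} {v} u≤v =
  subst (_≤ ⌊ u + v /2⌋) (sym (n≡⌊n+n/2⌋ u)) (⌊n/2⌋-mono (+-monoʳ-≤ u u≤v))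

⊓≤half : ∀ u v → u ⊓ v ≤ ⌊ u + v /2⌋
⊓≤half u v with ≤-total u v
... | inj₁ u≤v = ≤-trans (m⊓n≤m u v) (u≤v⇒u≤half u≤v)
... | inj₂ v≤u = ≤-trans (m⊓n≤n u v)
  (subst (λ k → v ≤ ⌊ k /2⌋) (+-comm v u) (u≤v⇒u≤half v≤u))

-- If the minimum attains its bound, the smaller part is the floor of half the sum, and its
-- complement is then the ceiling.
⊓≡half⇒halves : ∀ {u v} → u ⊓ v ≡ ⌊ u + v /2⌋ → Halves (u + v) u v
⊓≡half⇒halves {u} {v} eq with ≤-total u v
... | inj₁ u≤v = inj₁ (u≡ , complement-⌊⌋ u≡)
  where
  u≡ : u ≡ ⌊ u + v /2⌋
  u≡ = trans (sym (m≤n⇒m⊓n≡m u≤v)) eq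
... | inj₂ v≤u = inj₂ (subst (λ k → u ≡ ⌈ k /2⌉) (+-comm v u) (complement-⌊⌋ v≡′) , v≡)
  where
  v≡ : v ≡ ⌊ u + v /2⌋
  v≡ = trans (sym (m≥n⇒m⊓n≡n v≤u)) eq
  v≡′ : v ≡ ⌊ v + u /2⌋
  v≡′ = trans v≡ (cong ⌊_/2⌋ (+-comm u v))

halves⇒⊓≡half : ∀ {m u v} → Halves m u v → u ⊓ v ≡ ⌊ m /2⌋
halves⇒⊓≡half {m} (inj₁ (refl , refl)) = m≤n⇒m⊓n≡m (⌊n/2⌋≤⌈n/2⌉ m)
halves⇒⊓≡half {m} (inj₂ (refl , refl)) = m≥n⇒m⊓n≡n (⌊n/2⌋≤⌈n/2⌉ m)

-- With `u` and `v` free payphones on either side, `suc (u ⊓ v)` is the distance to the nearer wall.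
-- The first argument, the length of the gap, tells the sandwiched payphone from one beside a single
-- wall.
midScore : ℕ → ℕ → ℕ → ℕ
midScore (suc (suc _)) u v = suc (u ⊓ v)
midScore _             u v = 0

midScore≤phase : ∀ u v → midScore (suc (u + v)) u v ≤ phase (suc (u + v))
midScore≤phase u v with u + v in eq
... | zero  = z≤n
... | suc m = s≤s (subst (λ k → u ⊓ v ≤ ⌊ k /2⌋) eq (⊓≤half u v))

midScore≡phase⇒halves : ∀ u v → midScore (suc (u + v)) u v ≡ phase (suc (u + v)) →
  Halves (u + v) u v
midScore≡phase⇒halves zero    zero    _  = inj₁ (refl , refl)
midScore≡phase⇒halves zero    (suc v) eq = ⊓≡half⇒halves {0} (suc-injective eq)
midScore≡phase⇒halves (suc u) v       eq = ⊓≡half⇒halves {suc u} (suc-injective eq)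

halves⇒midScore≡phase : ∀ u v → Halves (u + v) u v →
  midScore (suc (u + v)) u v ≡ phase (suc (u + v))
halves⇒midScore≡phase u v h with u + v
... | zero  = refl
... | suc m = cong suc (halves⇒⊓≡half h)

items-halves : ∀ {u v} → Halves (u + v) u v →
  items (suc (u + v)) ↭ item (suc (u + v)) ∷ items u ++ items v
items-halves {u} {v} h = ↭-trans (↭-reflexive (items-suc (u + v))) (↭-prep _ (go h))
  where
  go : ∀ {m u v} → Halves m u v → items ⌊ m /2⌋ ++ items ⌈ m /2⌉ ↭ items u ++ items v
  go (inj₁ (refl , refl)) = ↭-refl
  go {m} (inj₂ (refl , refl)) = Perm.++-comm (items ⌊ m /2⌋) (items ⌈ m /2⌉)

items-< : ∀ {u m} → u ≤ ⌈ m /2⌉ → All (λ x → proj₁ x < phase (suc m)) (items u)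
items-< {zero}  {zero}  _ = []
items-< {u}     {suc m} u≤ = All.map
  (λ le → s≤s (≤-trans le (≤-trans (phase-mono u≤) (phase-half m)))) (items-phase u)

halves-< : ∀ {m u v} → Halves m u v →
  All (λ x → proj₁ x < phase (suc m)) (items u ++ items v)
halves-< {m} (inj₁ (refl , refl)) =
  All.++⁺ (items-< {m = m} (⌊n/2⌋≤⌈n/2⌉ m)) (items-< {m = m} ≤-refl)
halves-< {m} (inj₂ (refl , refl)) =
  All.++⁺ (items-< {m = m} ≤-refl) (items-< {m = m} (⌊n/2⌋≤⌈n/2⌉ m))

-- left b, mid a b and right a b consist of the payphones x < b resp.
-- a < x < b; in the valid ones, a and b are occupied, except that b is the
-- number of payphones in right a b.
data Gap : Set where
  left      : ℕ → Gap
  mid right : ℕ → ℕ → Gap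

Inside : Gap → ℕ → Set
Inside (left b)    x = x < b
Inside (mid a b)   x = a < x × x < b
Inside (right a b) x = a < x × x < b

split : Gap → ℕ → List Gap
split (left b)    x = left x ∷ mid x b ∷ []
split (mid a b)   x = mid a x ∷ mid x b ∷ []
split (right a b) x = mid a x ∷ right x b ∷ []

-- The person prefers the highest score: it is the distance from the closest
-- occupied payphone, lowered from 1 to 0 for a sandwiched payphone.
score : Gap → ℕ → ℕ
score (left b)    x = b ∸ x
score (mid a b)   x = midScore (b ∸ suc a) (x ∸ suc a) (b ∸ suc x)
score (right a b) x = x ∸ a

topScore : Gap → ℕ
topScore (left b)    = b
topScore (mid a b)   = phase (b ∸ suc a)
topScore (right a b) = b ∸ suc a

tops : Gap → List ℕ
tops (left zero)    = []
tops (left (suc b)) = [ 0 ]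
tops (mid a b) with b ∸ suc a
... | zero  = []
... | suc m = map (suc a +_) (topOffsets m)
tops (right a b) with b ∸ suc a
... | zero  = []
... | suc e = [ suc (a + e) ]

gapItems : Gap → List Item
gapItems (left b)    = endItems b
gapItems (mid a b)   = items (b ∸ suc a)
gapItems (right a b) = endItems (b ∸ suc a)

-- The count uses only this interface, not the kind of the gap. In `split-items` the left-hand side
-- is free of `x`: whichever top is taken, the remaining items are the same up to order.
record Peak (g : Gap) : Set where
  field
    top-inside   : ∀ {x} → x ∈ tops g → Inside g x
    top-score    : ∀ {x} → x ∈ tops g → score g x ≡ topScore g
    score≤top    : ∀ {x} → Inside g x → score g x ≤ topScore g
    top-complete : ∀ {x} → Inside g x → score g x ≡ topScore g → x ∈ tops g
    top-unique   : Unique (tops g)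
    split-items  : ∀ {x} → x ∈ tops g →
      gapItems g ↭ (topScore g , length (tops g)) ∷ concatMap gapItems (split g x)
    split-lower  : ∀ {x} → x ∈ tops g →
      All (λ i → proj₁ i < topScore g) (concatMap gapItems (split g x))
    empty⊎top    : ((∀ {x} → ¬ Inside g x) × tops g ≡ [] × gapItems g ≡ []) ⊎ ∃ (_∈ tops g)

empty-peak : ∀ {g} → (∀ {x} → ¬ Inside g x) → tops g ≡ [] → gapItems g ≡ [] → Peak g
empty-peak {g} none no-tops no-items = record
  { top-inside   = λ x∈ → contradiction (subst (_ ∈_) no-tops x∈) λ ()
  ; top-score    = λ x∈ → contradiction (subst (_ ∈_) no-tops x∈) λ ()
  ; score≤top    = λ x∈ → contradiction x∈ none
  ; top-complete = λ x∈ → contradiction x∈ none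
  ; top-unique   = subst Unique (sym no-tops) []
  ; split-items  = λ x∈ → contradiction (subst (_ ∈_) no-tops x∈) λ ()
  ; split-lower  = λ x∈ → contradiction (subst (_ ∈_) no-tops x∈) λ ()
  ; empty⊎top    = inj₁ (none , no-tops , no-items)
  }

items-phase-< : ∀ l → All (λ x → proj₁ x < suc l) (items l)
items-phase-< l = All.map (λ le → s≤s (≤-trans le (phase≤ l))) (items-phase l)

left-peak : ∀ b → Peak (left b)
left-peak zero = empty-peak (λ ()) refl refl
left-peak (suc b) = record
  { top-inside   = λ { (here refl) → z<s }
  ; top-score    = λ { (here refl) → refl }
  ; score≤top    = λ {x} _ → m∸n≤m (suc b) x
  ; top-complete = λ { {zero} _ _ → here refl
                     ; {suc x} _ eq → contradiction eq (<⇒≢ (s≤s (m∸n≤m b x))) }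
  ; top-unique   = [] ∷ []
  ; split-items  = λ { (here refl) → ↭-reflexive (cong ((suc b , 1) ∷_) (sym (++-identityʳ (items b)))) }
  ; split-lower  = λ { (here refl) → All.++⁺ (items-phase-< b) [] }
  ; empty⊎top    = inj₂ (0 , here refl)
  }
-- Nonempty gaps are reindexed by `suc m`, their length, so that the truncated subtractions in
-- `score` and `tops` become explicit.
data Span (a : ℕ) : ℕ → Set where
  empty : ∀ {b} → b ≤ suc a → Span a b
  span  : ∀ m → Span a (suc a + suc m)

span? : ∀ a b → Span a b
span? a b with suc (suc a) ≤? b
... | no  ab = empty (≮⇒≥ ab)
... | yes ab with m , refl ← m≤n⇒∃[o]m+o≡n ab = subst (Span a) (+-suc (suc a) m) (span m)

span-∸ : ∀ a m → a + suc m ∸ a ≡ suc m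
span-∸ a m = m+n∸m≡n a (suc m)

data Between (a : ℕ) : ℕ → ℕ → Set where
  between : ∀ u v → Between a (u + v) (suc a + u)

between? : ∀ a m {x} → a < x → x < suc a + suc m → Between a m x
between? a m ax xb with u , refl ← m≤n⇒∃[o]m+o≡n ax
  with v , refl ← m≤n⇒∃[o]m+o≡n (s≤s⁻¹ (+-cancelˡ-< (suc a) u (suc m) xb)) = between u v

module _ (a u v : ℕ) where

  offset-left : suc a + u ∸ suc a ≡ u
  offset-left = m+n∸m≡n a u

  offset-right : suc a + suc (u + v) ∸ suc (suc a + u) ≡ v
  offset-right = trans (cong (_∸ suc (a + u)) (trans (+-suc a (u + v)) (cong suc (sym (+-assoc a u v)))))
    (m+n∸m≡n (suc (a + u)) v)

mid-peak : ∀ a b → Peak (mid a b)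
mid-peak a b with span? a b
... | empty b≤ = empty-peak none no-tops (cong items (m≤n⇒m∸n≡0 b≤))
  where
  none : ∀ {x} → ¬ Inside (mid a b) x
  none (ax , xb) = <⇒≱ (≤-<-trans ax xb) b≤
  no-tops : tops (mid a b) ≡ []
  no-tops rewrite m≤n⇒m∸n≡0 b≤ = refl
... | span m = record
  { top-inside = λ x∈ → inside (∈tops⁻ x∈)
  ; top-score = λ x∈ → topScore≡ (∈tops⁻ x∈)
  ; score≤top = λ (ax , xb) → score≤ (between? a m ax xb)
  ; top-complete = λ (ax , xb) → complete (between? a m ax xb)
  ; top-unique = subst Unique (sym tops≡) (Unique.map⁺ (+-cancelˡ-≡ (suc a) _ _) (topOffsets-unique m))
  ; split-items = λ x∈ → split-items (∈tops⁻ x∈)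
  ; split-lower = λ x∈ → split-lower (∈tops⁻ x∈)
  ; empty⊎top = inj₂ (suc a + ⌊ m /2⌋ , subst (suc a + ⌊ m /2⌋ ∈_) (sym tops≡) (∈-map⁺ (suc a +_) (first m)))
  }
  where
  g : Gap
  g = mid a (suc a + suc m)

  tops≡ : tops g ≡ map (suc a +_) (topOffsets m)
  tops≡ rewrite span-∸ a m = refl

  top≡ : topScore g ≡ phase (suc m)
  top≡ = cong phase (span-∸ a m)

  first : ∀ m → ⌊ m /2⌋ ∈ topOffsets m
  first m with balanced? m
  ... | yes _ = here refl
  ... | no _  = here refl

  Top : ℕ → Set
  Top x = ∃ λ u → ∃ λ v → x ≡ suc a + u × u + v ≡ m × Halves m u v

  ∈tops⁻ : ∀ {x} → x ∈ tops g → Top x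
  ∈tops⁻ x∈ with u , u∈ , refl ← ∈-map⁻ (suc a +_) (subst (_ ∈_) tops≡ x∈)
    with topOffsets-halves u∈
  ... | v , eq , h = u , v , refl , eq , h

  score≡ : ∀ u v → u + v ≡ m → score g (suc a + u) ≡ midScore (suc (u + v)) u v
  score≡ u v refl rewrite span-∸ a (u + v) | offset-left a u v | offset-right a u v = refl

  inside : ∀ {x} → Top x → Inside g x
  inside (u , v , refl , refl , _) = m≤m+n (suc a) u , +-monoʳ-< (suc a) (s≤s (m≤m+n u v))

  topScore≡ : ∀ {x} → Top x →
    score g x ≡ topScore g
  topScore≡ (u , v , refl , refl , h) =
    trans (score≡ u v refl) (trans (halves⇒midScore≡phase u v h) (sym top≡))

  score≤ : ∀ {x} → Between a m x → score g x ≤ topScore g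
  score≤ (between u v) = subst₂ _≤_ (sym (score≡ u v refl)) (sym top≡) (midScore≤phase u v)

  complete : ∀ {x} → Between a m x → score g x ≡ topScore g → x ∈ tops g
  complete (between u v) eq = subst (_ ∈_) (sym tops≡) (∈-map⁺ (suc a +_) (∈-topOffsets⁺
    (midScore≡phase⇒halves u v (trans (sym (score≡ u v refl)) (trans eq top≡)))))

  parts≡ : ∀ u v → u + v ≡ m → concatMap gapItems (split g (suc a + u)) ≡ items u ++ items v
  parts≡ u v refl = cong₂ _++_ (cong items (offset-left a u v))
    (trans (++-identityʳ _) (cong items (offset-right a u v)))

  split-items : ∀ {x} → Top x →
    gapItems g ↭ (topScore g , length (tops g)) ∷ concatMap gapItems (split g x)
  split-items (u , v , refl , refl , h) = ↭-trans (↭-reflexive (cong items (span-∸ a m)))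
    (↭-trans (items-halves h) (↭-reflexive (cong₂ _∷_
      (cong₂ _,_ (sym top≡) (sym (trans (cong length tops≡)
        (trans (length-map (suc a +_) (topOffsets m)) (length-topOffsets m)))))
      (sym (parts≡ u v refl)))))

  split-lower : ∀ {x} → Top x →
    All (λ i → proj₁ i < topScore g) (concatMap gapItems (split g x))
  split-lower (u , v , refl , refl , h) =
    subst₂ (λ k xs → All (λ i → proj₁ i < k) xs) (sym top≡) (sym (parts≡ u v refl)) (halves-< h)

right-peak : ∀ a b → Peak (right a b)
right-peak a b with span? a b
... | empty b≤ = empty-peak none no-tops (cong endItems (m≤n⇒m∸n≡0 b≤))
  where
  none : ∀ {x} → ¬ Inside (right a b) x
  none (ax , xb) = <⇒≱ (≤-<-trans ax xb) b≤
  no-tops : tops (right a b) ≡ []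
  no-tops rewrite m≤n⇒m∸n≡0 b≤ = refl
... | span m = record
  { top-inside = λ x∈ → inside (∈tops⁻ x∈)
  ; top-score = λ x∈ → topScore≡ (∈tops⁻ x∈)
  ; score≤top = λ (ax , xb) → score≤ (between? a m ax xb)
  ; top-complete = λ (ax , xb) → complete (between? a m ax xb)
  ; top-unique = subst Unique (sym tops≡) ([] ∷ [])
  ; split-items = λ x∈ → split-items (∈tops⁻ x∈)
  ; split-lower = λ x∈ → split-lower (∈tops⁻ x∈)
  ; empty⊎top = inj₂ (suc (a + m) , subst (suc (a + m) ∈_) (sym tops≡) (here refl))
  }
  where
  g : Gap
  g = right a (suc a + suc m)

  tops≡ : tops g ≡ [ suc (a + m) ]
  tops≡ rewrite span-∸ a m = refl

  top≡ : topScore g ≡ suc m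
  top≡ = span-∸ a m

  ∈tops⁻ : ∀ {x} → x ∈ tops g → x ≡ suc (a + m)
  ∈tops⁻ x∈ with here eq ← subst (_ ∈_) tops≡ x∈ = eq

  score≡ : ∀ u → score g (suc (a + u)) ≡ suc u
  score≡ u = trans (cong (_∸ a) (sym (+-suc a u))) (m+n∸m≡n a (suc u))

  inside : ∀ {x} → x ≡ suc (a + m) → Inside g x
  inside refl = m≤m+n (suc a) m , +-monoʳ-< (suc a) ≤-refl

  topScore≡ : ∀ {x} → x ≡ suc (a + m) → score g x ≡ topScore g
  topScore≡ refl = trans (score≡ m) (sym top≡)

  score≤ : ∀ {x} → Between a m x → score g x ≤ topScore g
  score≤ (between u v) = subst₂ _≤_ (sym (score≡ u)) (sym top≡) (s≤s (m≤m+n u v))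

  complete : ∀ {x} → Between a m x → score g x ≡ topScore g → x ∈ tops g
  complete (between u v) eq = subst (_ ∈_) (sym tops≡) (here (cong (λ k → suc (a + k))
    (suc-injective (trans (sym (score≡ u)) (trans eq top≡)))))

  parts≡ : concatMap gapItems (split g (suc (a + m))) ≡ items m
  parts≡ = trans (cong₂ _++_ (cong items (m+n∸m≡n a m))
    (trans (++-identityʳ _) (cong endItems (m≤n⇒m∸n≡0 (≤-reflexive (+-suc (suc a) m))))))
    (++-identityʳ (items m))

  split-items : ∀ {x} → x ≡ suc (a + m) →
    gapItems g ↭ (topScore g , length (tops g)) ∷ concatMap gapItems (split g x)
  split-items refl = ↭-reflexive (trans (cong endItems (span-∸ a m))
    (cong₂ _∷_ (cong₂ _,_ (sym top≡) (sym (cong length tops≡))) (sym parts≡)))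

  split-lower : ∀ {x} → x ≡ suc (a + m) →
    All (λ i → proj₁ i < topScore g) (concatMap gapItems (split g x))
  split-lower refl =
    subst₂ (λ k xs → All (λ i → proj₁ i < k) xs) (sym top≡) (sym parts≡) (items-phase-< m)

peak : ∀ g → Peak g
peak (left b)    = left-peak b
peak (mid a b)   = mid-peak a b
peak (right a b) = right-peak a b

-- Rule (P5) as the maximisation of a score

module _ {n : ℕ} where

  private
    variable
      O : Subset n
      i j w : Fin n
      d s : ℕ

  closest≡ : w ∈ₛ O → dist w j ≡ d → (∀ i → i ∈ₛ O → d ≤ dist i j) → closest O j ≡ d
  closest≡ {w} {O} {j} {d} w∈ refl far = ≤-antisym
    (min≤v⁺ n _ (inj₂ (lose (∈-map⁺ (dist j) (∈-filter⁺ (_∈ₛ? O) (∈-allFin w) w∈))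
      (≤-reflexive (∣-∣-comm (toℕ j) (toℕ w))))))
    -- The minimum in `closest` also ranges over its default `n`, which exceeds every distance.
    (v≤min⁺ (<⇒≤ (dist<n w j)) (All.map⁺ (All.tabulate λ {i} i∈ →
      subst (d ≤_) (∣-∣-comm (toℕ i) (toℕ j)) (far i (proj₂ (∈-filter⁻ (_∈ₛ? O) {xs = allFin n} i∈))))))
    where
    dist<n : ∀ (i j : Fin n) → dist i j < n
    dist<n i j = ≤-<-trans (∣m-n∣≤m⊔n (toℕ i) (toℕ j)) (⊔-lub (Fin.toℕ<n i) (Fin.toℕ<n j))

  -- The distance is `s ⊔ 1` because a sandwiched payphone has score 0 but distance 1. The last
  -- three fields separate the scores 0 and 1, which distances cannot.
  record Scored (O : Subset n) (j : Fin n) (s : ℕ) : Set where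
    field
      available  : Available O j
      nearest    : ∃ λ w → w ∈ₛ O × dist w j ≡ s ⊔ 1
      far        : ∀ i → i ∈ₛ O → s ⊔ 1 ≤ dist i j
      beside⇒    : BesideOne O j → s ≡ 1
      ⇒beside    : s ≡ 1 → BesideOne O j
      ⇒sandwiched : s ≡ 0 → Sandwiched O j

  module _ (scored : Scored O j s) where
    open Scored scored

    scored⇒closest : closest O j ≡ s ⊔ 1
    scored⇒closest with w , w∈ , eq ← nearest = closest≡ w∈ eq far

    scored⇒spacious : 2 ≤ s → Spacious O j
    scored⇒spacious 2≤s = available , λ i i∈ → ≤-trans (≤-trans 2≤s (m≤m⊔n s 1)) (far i i∈)

    spacious⇒2≤score : Spacious O j → 2 ≤ s
    spacious⇒2≤score (_ , sp) with w , w∈ , eq ← nearest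
      with ≤-total s 1
    ... | inj₁ s≤1 = contradiction
      (subst (2 ≤_) (trans eq (m≤n⇒m⊔n≡n s≤1)) (sp w w∈)) 1+n≰n
    ... | inj₂ 1≤s = subst (2 ≤_) (trans eq (m≥n⇒m⊔n≡m 1≤s)) (sp w w∈)

  ⊔1-cancel : 2 ≤ d ⊔ 1 → 2 ≤ d
  ⊔1-cancel {zero}  (s≤s ())
  ⊔1-cancel {suc d} 2≤ = subst (2 ≤_) (m≥n⇒m⊔n≡m {suc d} (s≤s z≤n)) 2≤

  -- The three clauses of the rule correspond to a best score of at least 2, of exactly 1 and of
  -- exactly 0.
  P5⇒maximal : (∀ i → Available O i → ∃ (Scored O i)) →
    Scored O j s → P5 O j → ∀ {i t} → Scored O i t → t ≤ s
  P5⇒maximal {j = j} {s} all sc (inj₁ ((k , sp) , _ , furthest)) {i} {t} sc′ =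
    ≤-trans (m≤m⊔n t 1) (subst (t ⊔ 1 ≤_) (m≥n⇒m⊔n≡m (≤-trans (n≤1+n 1) 2≤s)) (closer sc′))
    where
    closer : ∀ {i t} → Scored _ i t → t ⊔ 1 ≤ s ⊔ 1
    closer {i} sc′ = subst₂ _≤_ (scored⇒closest sc′) (scored⇒closest sc)
      (furthest i (Scored.available sc′))
    2≤s : 2 ≤ s
    -- (P1) compares distances only, which agree for the scores 0 and 1; the spacious payphone `k`
    -- lifts the maximum above both.
    2≤s with t′ , sck ← all k (proj₁ sp) =
      ⊔1-cancel (≤-trans (≤-trans (spacious⇒2≤score sck sp) (m≤m⊔n t′ 1)) (closer sck))
  P5⇒maximal _ sc (inj₂ (inj₁ (crowded , beside))) {i} {t} sc′ =
    subst (t ≤_) (sym (Scored.beside⇒ sc beside))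
      (≮⇒≥ λ 2≤t → crowded (i , scored⇒spacious sc′ 2≤t))
  P5⇒maximal _ _ (inj₂ (inj₂ (_ , _ , _))) {t = zero} _ = z≤n
  P5⇒maximal _ _ (inj₂ (inj₂ (_ , none , _))) {i} {t = 1} sc′ =
    contradiction (i , Scored.⇒beside sc′ refl) none
  P5⇒maximal _ _ (inj₂ (inj₂ (crowded , _ , _))) {i} {suc (suc t)} sc′ =
    contradiction (i , scored⇒spacious sc′ (s≤s (s≤s z≤n))) crowded

  maximal⇒P5 : Scored O j s → (∀ i → Available O i → ∃ λ t → Scored O i t × t ≤ s) → P5 O j
  maximal⇒P5 {O} {j} {s} sc all = by-score s sc all
    where
    crowded : ∀ {s} → (∀ i → Available O i → ∃ λ t → Scored O i t × t ≤ s) → s ≤ 1 → ¬ ∃ (Spacious O)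
    crowded all s≤1 (i , sp) with t , sc′ , t≤s ← all i (proj₁ sp) =
      <⇒≱ (spacious⇒2≤score sc′ sp) (≤-trans t≤s s≤1)

    by-score : ∀ s → Scored O j s → (∀ i → Available O i → ∃ λ t → Scored O i t × t ≤ s) → P5 O j
    by-score zero sc all = inj₂ (inj₂ (crowded all z≤n , none , Scored.⇒sandwiched sc refl))
      where
      none : ¬ ∃ (BesideOne O)
      none (i , b) with t , sc′ , t≤0 ← all i (proj₁ b) =
        <⇒≱ (≤-reflexive (sym (Scored.beside⇒ sc′ b))) t≤0
    by-score 1 sc all = inj₂ (inj₁ (crowded all ≤-refl , Scored.⇒beside sc refl))
    by-score (suc (suc s)) sc all = inj₁
      ( (j , scored⇒spacious sc (s≤s (s≤s z≤n)))
      , Scored.available sc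
      , λ i av → let t , sc′ , t≤s = all i av in
          subst₂ _≤_ (sym (scored⇒closest sc′)) (sym (scored⇒closest sc)) (⊔-monoˡ-≤ 1 t≤s))

  -- Every other occupied payphone is strictly farther than the wall `w`; at distance 1, `w` is
  -- therefore the only occupied neighbour.
  scored-oneWall : ∀ d → Available O j → w ∈ₛ O → dist w j ≡ suc d →
    (∀ i → i ∈ₛ O → i ≡ w ⊎ dist w j < dist i j) → Scored O j (suc d)
  scored-oneWall {O} {j} {w} d av w∈ w≡ others = record
    { available   = av
    ; nearest     = w , w∈ , trans w≡ (sym (cong suc (⊔-identityʳ d)))
    ; far         = λ i i∈ → subst (_≤ dist i j) (sym (cong suc (⊔-identityʳ d))) (further i i∈)
    ; beside⇒     = λ (_ , i , (i∈ , i≡1) , _) → ≤-antisym (subst (suc d ≤_) i≡1 (further i i∈)) (s≤s z≤n)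
    ; ⇒beside     = λ d≡ → av , w , (w∈ , trans w≡ d≡) , λ {y} (y∈ , y≡1) → unique d≡ y y∈ y≡1
    ; ⇒sandwiched = λ ()
    }
    where
    further : ∀ i → i ∈ₛ O → suc d ≤ dist i j
    further i i∈ with others i i∈
    ... | inj₁ refl = ≤-reflexive (sym w≡)
    ... | inj₂ lt   = subst (_≤ dist i j) w≡ (<⇒≤ lt)
    unique : suc d ≡ 1 → ∀ y → y ∈ₛ O → dist y j ≡ 1 → w ≡ y
    unique d≡ y y∈ y≡1 with others y y∈
    ... | inj₁ y≡w = sym y≡w
    ... | inj₂ lt  = contradiction (subst₂ _<_ (trans w≡ d≡) y≡1 lt) 1+n≰n

  module _ {O : Subset n} {j w₁ w₂ : Fin n} {u v}
    (av : Available O j) (w₁∈ : w₁ ∈ₛ O) (w₂∈ : w₂ ∈ₛ O)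
    (j≡ : toℕ j ≡ suc (toℕ w₁ + u)) (w₂≡ : toℕ w₂ ≡ suc (toℕ j + v))
    (others : ∀ i → i ∈ₛ O → (i ≡ w₁ ⊎ dist w₁ j < dist i j) ⊎ (i ≡ w₂ ⊎ dist w₂ j < dist i j))
    where

    private
      dist₁ : dist w₁ j ≡ suc u
      dist₁ = trans (cong (λ k → ∣ toℕ w₁ - k ∣) (trans j≡ (sym (+-suc (toℕ w₁) u))))
        (∣m-m+n∣≡n (toℕ w₁) (suc u))

      dist₂ : dist w₂ j ≡ suc v
      dist₂ = trans (cong (λ k → ∣ k - toℕ j ∣) (trans w₂≡ (sym (+-suc (toℕ j) v))))
        (trans (∣-∣-comm (toℕ j + suc v) (toℕ j)) (∣m-m+n∣≡n (toℕ j) (suc v)))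

      w₁≢w₂ : w₁ ≢ w₂
      w₁≢w₂ refl = <-asym (subst (toℕ w₁ <_) (sym j≡) (s≤s (m≤m+n _ u)))
                          (subst (toℕ j <_) (sym w₂≡) (s≤s (m≤m+n _ v)))

      further : ∀ i → i ∈ₛ O → suc (u ⊓ v) ≤ dist i j
      further i i∈ with others i i∈
      ... | inj₁ (inj₁ refl) = subst (_ ≤_) (sym dist₁) (s≤s (m⊓n≤m u v))
      ... | inj₁ (inj₂ lt)   = ≤-trans (s≤s (m⊓n≤m u v)) (subst (_≤ dist i j) dist₁ (<⇒≤ lt))
      ... | inj₂ (inj₁ refl) = subst (_ ≤_) (sym dist₂) (s≤s (m⊓n≤n u v))
      ... | inj₂ (inj₂ lt)   = ≤-trans (s≤s (m⊓n≤n u v)) (subst (_≤ dist i j) dist₂ (<⇒≤ lt))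

      adjacent : ∀ i → i ∈ₛ O → dist i j ≡ 1 → (i ≡ w₁ × u ≡ 0) ⊎ (i ≡ w₂ × v ≡ 0)
      adjacent i i∈ i≡1 with others i i∈
      ... | inj₁ (inj₁ refl) = inj₁ (refl , suc-injective (trans (sym dist₁) i≡1))
      ... | inj₁ (inj₂ lt)   = contradiction (subst₂ _<_ dist₁ i≡1 lt) λ { (s≤s ()) }
      ... | inj₂ (inj₁ refl) = inj₂ (refl , suc-injective (trans (sym dist₂) i≡1))
      ... | inj₂ (inj₂ lt)   = contradiction (subst₂ _<_ dist₂ i≡1 lt) λ { (s≤s ()) }

    scored-sandwiched : u ≡ 0 → v ≡ 0 → Scored O j 0
    scored-sandwiched refl refl = record
      { available   = av
      ; nearest     = w₁ , w₁∈ , dist₁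
      ; far         = further
      ; beside⇒     = λ (_ , _ , _ , i!) →
          contradiction (trans (sym (i! (w₁∈ , dist₁))) (i! (w₂∈ , dist₂))) w₁≢w₂
      ; ⇒beside     = λ ()
      ; ⇒sandwiched = λ _ → av
          , (w₁ , trans (cong suc (sym (+-identityʳ _))) (sym j≡) , w₁∈)
          , (w₂ , trans w₂≡ (cong suc (+-identityʳ _)) , w₂∈)
      }

    -- As `u + v` is positive, the walls are not both adjacent, so at distance 1 exactly one
    -- neighbour is occupied.
    scored-wide : 1 ≤ u + v → Scored O j (suc (u ⊓ v))
    scored-wide wide = record
      { available   = av
      ; nearest     = near
      ; far         = λ i i∈ → subst (_≤ dist i j) (sym (cong suc (⊔-identityʳ (u ⊓ v)))) (further i i∈)
      ; beside⇒     = λ (_ , i , (i∈ , i≡1) , _) → ≤-antisym (subst (_ ≤_) i≡1 (further i i∈)) (s≤s z≤n)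
      ; ⇒beside     = λ eq → av , beside (suc-injective eq)
      ; ⇒sandwiched = λ ()
      }
      where
      near : ∃ λ w → w ∈ₛ O × dist w j ≡ suc (u ⊓ v) ⊔ 1
      near with ≤-total u v
      ... | inj₁ u≤v = w₁ , w₁∈ ,
        trans dist₁ (sym (cong suc (trans (⊔-identityʳ _) (m≤n⇒m⊓n≡m u≤v))))
      ... | inj₂ v≤u = w₂ , w₂∈ ,
        trans dist₂ (sym (cong suc (trans (⊔-identityʳ _) (m≥n⇒m⊓n≡n v≤u))))

      not-both : u ≡ 0 → v ≢ 0
      not-both u≡0 v≡0 = contradiction (subst₂ (λ a b → 1 ≤ a + b) u≡0 v≡0 wide) λ ()

      beside : u ⊓ v ≡ 0 → ∃! _≡_ (λ i → i ∈ₛ O × dist i j ≡ 1)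
      beside eq with ≤-total u v
      ... | inj₁ u≤v = w₁ , (w₁∈ , trans dist₁ (cong suc u≡0)) , λ {y} (y∈ , y≡1) → unique y y∈ y≡1
        where
        u≡0 = trans (sym (m≤n⇒m⊓n≡m u≤v)) eq
        unique : ∀ y → y ∈ₛ O → dist y j ≡ 1 → w₁ ≡ y
        unique y y∈ y≡1 with adjacent y y∈ y≡1
        ... | inj₁ (y≡ , _)  = sym y≡
        ... | inj₂ (_ , v≡0) = contradiction v≡0 (not-both u≡0)
      ... | inj₂ v≤u = w₂ , (w₂∈ , trans dist₂ (cong suc v≡0)) , λ {y} (y∈ , y≡1) → unique y y∈ y≡1
        where
        v≡0 = trans (sym (m≥n⇒m⊓n≡n v≤u)) eq
        unique : ∀ y → y ∈ₛ O → dist y j ≡ 1 → w₂ ≡ y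
        unique y y∈ y≡1 with adjacent y y∈ y≡1
        ... | inj₁ (_ , u≡0) = contradiction v≡0 (not-both u≡0)
        ... | inj₂ (y≡ , _)  = sym y≡

  scored-twoWalls : ∀ {w₁ w₂} u v → Available O j → w₁ ∈ₛ O → w₂ ∈ₛ O →
    toℕ j ≡ suc (toℕ w₁ + u) → toℕ w₂ ≡ suc (toℕ j + v) →
    (∀ i → i ∈ₛ O → (i ≡ w₁ ⊎ dist w₁ j < dist i j) ⊎ (i ≡ w₂ ⊎ dist w₂ j < dist i j)) →
    Scored O j (midScore (suc (u + v)) u v)
  scored-twoWalls zero    zero    av w₁∈ w₂∈ j≡ w₂≡ others =
    scored-sandwiched av w₁∈ w₂∈ j≡ w₂≡ others refl refl
  scored-twoWalls zero    (suc v) av w₁∈ w₂∈ j≡ w₂≡ others =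
    scored-wide av w₁∈ w₂∈ j≡ w₂≡ others (s≤s z≤n)
  scored-twoWalls (suc u) v       av w₁∈ w₂∈ j≡ w₂≡ others =
    scored-wide av w₁∈ w₂∈ j≡ w₂≡ others (s≤s z≤n)

  -- Gaps of a set of occupied payphones

  Occupied : List (Fin n) → ℕ → Set
  Occupied js x = ∃ λ w → w ∈ js × toℕ w ≡ x

  Walled : List (Fin n) → Gap → Set
  Walled js (left b)    = Occupied js b
  Walled js (mid a b)   = Occupied js a × Occupied js b
  Walled js (right a b) = Occupied js a × b ≡ n

  Free : List (Fin n) → Gap → Set
  Free js g = ∀ {j} → Inside g (toℕ j) → j ∉ js

  Valid : List (Fin n) → Gap → Set
  Valid js g = Walled js g × Free js g

  private
    variable
      js : List (Fin n)
      g : Gap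
      x y z : ℕ

  ∣-∣-<ʳ : x ≤ y → y < z → ∣ y - x ∣ < ∣ z - x ∣
  ∣-∣-<ʳ {x} {y} {z} x≤y y<z = subst₂ _<_ (sym (m≤n⇒∣n-m∣≡n∸m x≤y))
    (sym (m≤n⇒∣n-m∣≡n∸m (≤-trans x≤y (<⇒≤ y<z)))) (∸-monoˡ-< y<z x≤y)

  ∣-∣-<ˡ : z < y → y ≤ x → ∣ y - x ∣ < ∣ z - x ∣
  ∣-∣-<ˡ {z} {y} {x} z<y y≤x = subst₂ _<_ (sym (m≤n⇒∣m-n∣≡n∸m y≤x))
    (sym (m≤n⇒∣m-n∣≡n∸m (≤-trans (<⇒≤ z<y) y≤x))) (∸-monoʳ-< z<y y≤x)

  wall-right : ∀ (j w i : Fin n) → toℕ j < toℕ w → toℕ w ≤ toℕ i → i ≡ w ⊎ dist w j < dist i j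
  wall-right j w i j<w w≤i with m≤n⇒m<n∨m≡n w≤i
  ... | inj₁ w<i = inj₂ (∣-∣-<ʳ (<⇒≤ j<w) w<i)
  ... | inj₂ w≡i = inj₁ (Fin.toℕ-injective (sym w≡i))

  wall-left : ∀ (j w i : Fin n) → toℕ w < toℕ j → toℕ i ≤ toℕ w → i ≡ w ⊎ dist w j < dist i j
  wall-left j w i w<j i≤w with m≤n⇒m<n∨m≡n i≤w
  ... | inj₁ i<w = inj₂ (∣-∣-<ˡ i<w (<⇒≤ w<j))
  ... | inj₂ i≡w = inj₁ (Fin.toℕ-injective i≡w)

  gap-scored : ∀ g → Valid js g → Inside g (toℕ j) → Scored (occupied js) j (score g (toℕ j))
  gap-scored {js} {j} (left b) ((w , w∈ , refl) , free) j<w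
    with k , w≡ ← m≤n⇒∃[o]m+o≡n j<w =
    subst (Scored (occupied js) j) (sym suc-k) (scored-oneWall k (∉⇒available (free j<w)) (∈-occupied⁺ w∈)
      (trans (m≤n⇒∣n-m∣≡n∸m (<⇒≤ j<w)) suc-k)
      λ i i∈ → wall-right j w i j<w (≮⇒≥ λ i<w → free i<w (∈-occupied⁻ i∈)))
    where
    suc-k : toℕ w ∸ toℕ j ≡ suc k
    suc-k = trans (cong (_∸ toℕ j) (trans (sym w≡) (sym (+-suc (toℕ j) k)))) (m+n∸m≡n (toℕ j) (suc k))
  gap-scored {js} {j} (right a b) (((w , w∈ , refl) , refl) , free) (w<j , j<n)
    with k , j≡ ← m≤n⇒∃[o]m+o≡n w<j =
    subst (Scored (occupied js) j) (sym suc-k)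
      (scored-oneWall k (∉⇒available (free (w<j , j<n))) (∈-occupied⁺ w∈)
      (trans (m≤n⇒∣m-n∣≡n∸m (<⇒≤ w<j)) suc-k)
      λ i i∈ → wall-left j w i w<j (≮⇒≥ λ w<i → free (w<i , Fin.toℕ<n i) (∈-occupied⁻ i∈)))
    where
    suc-k : toℕ j ∸ toℕ w ≡ suc k
    suc-k = trans (cong (_∸ toℕ w) (trans (sym j≡) (sym (+-suc (toℕ w) k)))) (m+n∸m≡n (toℕ w) (suc k))
  gap-scored {js} {j} (mid a b) (((w₁ , w₁∈ , refl) , (w₂ , w₂∈ , refl)) , free) (w₁<j , j<w₂)
    with u , j≡ ← m≤n⇒∃[o]m+o≡n w₁<j | v , w₂≡ ← m≤n⇒∃[o]m+o≡n j<w₂ =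
    subst (Scored (occupied js) j) (sym score≡)
      (scored-twoWalls u v (∉⇒available (free (w₁<j , j<w₂))) (∈-occupied⁺ w₁∈) (∈-occupied⁺ w₂∈)
        (sym j≡) (sym w₂≡) others)
    where
    offset : ∀ {x y} k → suc x + k ≡ y → y ∸ suc x ≡ k
    offset {x} k refl = m+n∸m≡n (suc x) k
    reassoc : ∀ a u v → suc a + suc (u + v) ≡ suc (suc a + u) + v
    reassoc a u v = trans (+-suc (suc a) (u + v)) (cong suc (sym (+-assoc (suc a) u v)))
    score≡ : score (mid (toℕ w₁) (toℕ w₂)) (toℕ j) ≡ midScore (suc (u + v)) u v
    score≡ rewrite offset u j≡ | offset v w₂≡
      | offset {toℕ w₁} {toℕ w₂} (suc (u + v))
          (trans (reassoc (toℕ w₁) u v) (trans (cong (λ k → suc k + v) j≡) w₂≡))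
      = refl
    others : ∀ i → i ∈ₛ occupied js →
      (i ≡ w₁ ⊎ dist w₁ j < dist i j) ⊎ (i ≡ w₂ ⊎ dist w₂ j < dist i j)
    others i i∈ with toℕ i ≤? toℕ w₁
    ... | yes i≤w₁ = inj₁ (wall-left j w₁ i w₁<j i≤w₁)
    ... | no  i≰w₁ = inj₂ (wall-right j w₂ i j<w₂
      (≮⇒≥ λ i<w₂ → free (≰⇒> i≰w₁ , i<w₂) (∈-occupied⁻ i∈)))

-- Lists up to permutation

concatMap-↭ : ∀ {A B : Set} (f : A → List B) {xs ys} → xs ↭ ys → concatMap f xs ↭ concatMap f ys
concatMap-↭ f Perm.refl = ↭-refl
concatMap-↭ f (Perm.prep x p) = Perm.++⁺ˡ (f x) (concatMap-↭ f p)
concatMap-↭ f (Perm.swap x y p) =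
  ↭-trans (Perm.shifts (f x) (f y)) (Perm.++⁺ˡ (f y) (Perm.++⁺ˡ (f x) (concatMap-↭ f p)))
concatMap-↭ f (Perm.trans p q) = ↭-trans (concatMap-↭ f p) (concatMap-↭ f q)

∈⇒↭ : ∀ {A : Set} {x : A} {xs} → x ∈ xs → ∃ λ ys → xs ↭ x ∷ ys
∈⇒↭ {x = x} x∈ with ys , zs , refl ← ∈-∃++ x∈ = ys ++ zs , Perm.shift x ys zs

-- The gap decomposition of a set of occupied payphones

DisjointGaps : Gap → Gap → Set
DisjointGaps g h = ∀ {x} → Inside g x → Inside h x → ⊥

split-covers : ∀ g {x y} → Inside g y → y ≢ x → ∃ λ h → h ∈ split g x × Inside h y
split-covers (left b) {x} {y} yb y≢x with <-cmp y x
... | tri< y<x _ _ = _ , here refl , y<x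
... | tri≈ _ y≡x _ = contradiction y≡x y≢x
... | tri> _ _ x<y = _ , there (here refl) , x<y , yb
split-covers (mid a b) {x} {y} (ay , yb) y≢x with <-cmp y x
... | tri< y<x _ _ = _ , here refl , ay , y<x
... | tri≈ _ y≡x _ = contradiction y≡x y≢x
... | tri> _ _ x<y = _ , there (here refl) , x<y , yb
split-covers (right a b) {x} {y} (ay , yb) y≢x with <-cmp y x
... | tri< y<x _ _ = _ , here refl , ay , y<x
... | tri≈ _ y≡x _ = contradiction y≡x y≢x
... | tri> _ _ x<y = _ , there (here refl) , x<y , yb

Within : Gap → ℕ → Gap → Set
Within g x h = ∀ y → Inside h y → Inside g y × y ≢ x

split-within : ∀ g {x} → Inside g x → All (Within g x) (split g x)
split-within (left b)    xb        = (λ _ y<x → <-trans y<x xb , <⇒≢ y<x)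
                                   ∷ (λ _ (x<y , yb) → yb , >⇒≢ x<y) ∷ []
split-within (mid a b)   (ax , xb) = (λ _ (ay , y<x) → (ay , <-trans y<x xb) , <⇒≢ y<x)
                                   ∷ (λ _ (x<y , yb) → (<-trans ax x<y , yb) , >⇒≢ x<y) ∷ []
split-within (right a b) (ax , xb) = (λ _ (ay , y<x) → (ay , <-trans y<x xb) , <⇒≢ y<x)
                                   ∷ (λ _ (x<y , yb) → (<-trans ax x<y , yb) , >⇒≢ x<y) ∷ []

split-disjoint : ∀ g x → AllPairs DisjointGaps (split g x)
split-disjoint (left b)    x = ((λ y<x (x<y , _) → <-asym y<x x<y) ∷ []) ∷ [] ∷ []
split-disjoint (mid a b)   x = ((λ (_ , y<x) (x<y , _) → <-asym y<x x<y) ∷ []) ∷ [] ∷ []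
split-disjoint (right a b) x = ((λ (_ , y<x) (x<y , _) → <-asym y<x x<y) ∷ []) ∷ [] ∷ []

disjoint-sym : ∀ {g h} → DisjointGaps g h → DisjointGaps h g
disjoint-sym disj in-h in-g = disj in-g in-h

module _ {n : ℕ} where

  record Decomposition (js : List (Fin n)) (gs : List Gap) : Set where
    field
      cover    : ∀ {j} → j ∉ js → ∃ λ g → g ∈ gs × Inside g (toℕ j)
      valid    : All (Valid js) gs
      disjoint : AllPairs DisjointGaps gs

  private
    variable
      js : List (Fin n)
      j : Fin n
      g : Gap
      gs hs : List Gap
      x : ℕ

  decomposition-↭ : gs ↭ hs → Decomposition js gs → Decomposition js hs
  decomposition-↭ p d = record
    { cover    = λ j∉ → let g , g∈ , ins = cover j∉ in g , Perm.∈-resp-↭ p g∈ , ins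
    ; valid    = Perm.All-resp-↭ p valid
    ; disjoint = AllPairs-resp-↭ (setoid Gap) disjoint-sym (resp₂ DisjointGaps)
        (↭⇒↭ₛ p) disjoint
    }
    where open Decomposition d

  occupied-∷ : Occupied js x → Occupied (j ∷ js) x
  occupied-∷ (w , w∈ , eq) = w , there w∈ , eq

  walled-∷ : ∀ g → Walled js g → Walled (j ∷ js) g
  walled-∷ (left b)    o       = occupied-∷ o
  walled-∷ (mid a b)   (o , p) = occupied-∷ o , occupied-∷ p
  walled-∷ (right a b) (o , e) = occupied-∷ o , e

  split-walled : ∀ g → Walled js g → All (Walled (j ∷ js)) (split g (toℕ j))
  split-walled (left b)    o       = (_ , here refl , refl) ∷ ((_ , here refl , refl) , occupied-∷ o) ∷ []
  split-walled (mid a b)   (o , p) =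
    (occupied-∷ o , _ , here refl , refl) ∷ ((_ , here refl , refl) , occupied-∷ p) ∷ []
  split-walled (right a b) (o , e) = (occupied-∷ o , _ , here refl , refl) ∷ ((_ , here refl , refl) , e) ∷ []

  decomposition-split : Inside g (toℕ j) → Decomposition js (g ∷ gs) →
    Decomposition (j ∷ js) (split g (toℕ j) ++ gs)
  decomposition-split {g} {j} {js} {gs} j-in record
    { cover = cover ; valid = (walled , free) ∷ valid ; disjoint = disj ∷ disjoint } = record
    { cover    = cover′
    ; valid    = All.++⁺
        (All.zip (split-walled g walled , All.map (λ {h} → free-split {h}) (split-within g j-in)))
        (All.zipWith (λ {h} → valid-rest {h}) (valid , disj))
    ; disjoint = AllPairs.++⁺ (split-disjoint g (toℕ j)) disjoint
        (All.map (λ {h} within → All.map (λ {k} → disjoint-split {h} {k} within) disj) (split-within g j-in))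
    }
    where
    valid-rest : ∀ {h} → Valid js h × DisjointGaps g h → Valid (j ∷ js) h
    valid-rest {h} ((w , f) , d) = walled-∷ h w ,
      λ { ins (here refl) → d j-in ins ; ins (there i∈) → f ins i∈ }
    disjoint-split : ∀ {h k} → Within g (toℕ j) h →
      DisjointGaps g k → DisjointGaps h k
    disjoint-split within d in-h in-k = d (proj₁ (within _ in-h)) in-k
    free-split : ∀ {h} → Within g (toℕ j) h → Free (j ∷ js) h
    free-split within ins (here refl) = proj₂ (within _ ins) refl
    free-split within ins (there i∈)  = free (proj₁ (within _ ins)) i∈
    cover′ : ∀ {i} → i ∉ j ∷ js → ∃ λ h → h ∈ split g (toℕ j) ++ gs × Inside h (toℕ i)
    cover′ i∉ with cover (i∉ ∘ there)
    ... | h , there h∈ , ins = h , ∈-++⁺ʳ _ h∈ , ins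
    ... | _ , here refl , ins
      with h , h∈ , ins′ ← split-covers g ins (i∉ ∘ here ∘ Fin.toℕ-injective) = h , ∈-++⁺ˡ h∈ , ins′

  -- The payphones of a gap that may be taken when r is the best score overall.
  topsAt : ℕ → Gap → List ℕ
  topsAt r g with topScore g ≟ r
  ... | yes _ = tops g
  ... | no  _ = []

  topsAt⁺ : x ∈ tops g → x ∈ topsAt (topScore g) g
  topsAt⁺ {g = g} x∈ with topScore g ≟ topScore g
  ... | yes _ = x∈
  ... | no ne = contradiction refl ne

  topsAt⁻ : ∀ {r} → x ∈ topsAt r g → x ∈ tops g × topScore g ≡ r
  topsAt⁻ {g = g} {r} x∈ with topScore g ≟ r
  ... | yes eq = x∈ , eq

  topsAt-unique : ∀ r g → Unique (topsAt r g)
  topsAt-unique r g with topScore g ≟ r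
  ... | yes _ = Peak.top-unique (peak g)
  ... | no _  = []

  -- The payphones that rule (P5) allows in a decomposition

  EmptyGap : Gap → Set
  EmptyGap g = (∀ {x} → ¬ Inside g x) × tops g ≡ [] × gapItems g ≡ []

  Best : List Gap → ℕ → Set
  Best gs r = ∀ {h x} → h ∈ gs → x ∈ tops h → topScore h ≤ r

  best : ∀ gs → All EmptyGap gs ⊎ ∃ λ g → g ∈ gs × ∃ (_∈ tops g) × Best gs (topScore g)
  best [] = inj₁ []
  best (g ∷ gs) with Peak.empty⊎top (peak g) | best gs
  ... | inj₁ e | inj₁ es = inj₁ (e ∷ es)
  ... | inj₁ (_ , e , _) | inj₂ (h , h∈ , t , b) = inj₂ (h , there h∈ , t , λ
    { (here refl) x∈ → contradiction (subst (_ ∈_) e x∈) λ () ; (there k∈) x∈ → b k∈ x∈ })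
  ... | inj₂ t | inj₁ es = inj₂ (g , here refl , t , λ
    { (here refl) _ → ≤-refl
    ; (there k∈) x∈ → contradiction (subst (_ ∈_) (proj₁ (proj₂ (All.lookup es k∈))) x∈) λ () })
  ... | inj₂ t | inj₂ (h , h∈ , t′ , b) with ≤-total (topScore g) (topScore h)
  ...   | inj₁ g≤h = inj₂ (h , there h∈ , t′ , λ { (here refl) _ → g≤h ; (there k∈) x∈ → b k∈ x∈ })
  ...   | inj₂ h≤g = inj₂ (g , here refl , t , λ
    { (here refl) _ → ≤-refl ; (there k∈) x∈ → ≤-trans (b k∈ x∈) h≤g })

  private
    toFin : Walled js g → Inside g x → x < n
    toFin {g = left b}    (w , _ , refl)       xb        = <-trans xb (Fin.toℕ<n w)
    toFin {g = mid a b}   (_ , w , _ , refl)   (_ , xb)  = <-trans xb (Fin.toℕ<n w)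
    toFin {g = right a b} (_ , refl)           (_ , xb)  = xb

  module _ (d : Decomposition js gs) where
    open Decomposition d

    all-scored : ∀ i → Available (occupied js) i →
      ∃ λ g → g ∈ gs × Inside g (toℕ i) × Scored (occupied js) i (score g (toℕ i))
    all-scored i av with g , g∈ , ins ← cover (av ∘ ∈-occupied⁺) =
      g , g∈ , ins , gap-scored g (All.lookup valid g∈) ins

    top⇒fin : g ∈ gs → x ∈ tops g → ∃ λ (i : Fin n) → toℕ i ≡ x
    top⇒fin {g} g∈ x∈ = fromℕ< x<n , Fin.toℕ-fromℕ< x<n
      where x<n = toFin {g = g} (proj₁ (All.lookup valid g∈)) (Peak.top-inside (peak g) x∈)

    inside⇒score≤best : ∀ {r} → Best gs r → g ∈ gs → Inside g x → score g x ≤ r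
    inside⇒score≤best {g} b g∈ ins with Peak.empty⊎top (peak g)
    ... | inj₁ (none , _) = contradiction ins none
    ... | inj₂ (_ , x∈)   = ≤-trans (Peak.score≤top (peak g) ins) (b g∈ x∈)

    top⇒P5 : Best gs (topScore g) → g ∈ gs → toℕ j ∈ tops g → P5 (occupied js) j
    top⇒P5 {g} {j} b g∈ x∈ = maximal⇒P5 (gap-scored g (All.lookup valid g∈) (Peak.top-inside (peak g) x∈))
      λ i av → let h , h∈ , ins , sc = all-scored i av in _ , sc ,
        subst (score h (toℕ i) ≤_) (sym (Peak.top-score (peak g) x∈)) (inside⇒score≤best b h∈ ins)

    -- The gap `h` around `j` is squeezed: `topScore h ≤ topScore g ≤ score h (toℕ j) ≤ topScore
    -- h`. Hence `j` is a top of `h`, and `h` is filled in the same phase as `g`.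
    P5⇒top : g ∈ gs → x ∈ tops g → Best gs (topScore g) → P5 (occupied js) j →
      toℕ j ∈ concatMap (topsAt (topScore g)) gs
    P5⇒top {g} {x} {j} g∈ x∈ b p5
      with h , h∈ , ins , sc ← all-scored j (P5⇒Available p5)
      with i , refl ← top⇒fin g∈ x∈ = go (≤-antisym (b h∈ (proj₂ nonempty)) (≤-trans r≤s s≤))
      where
      nonempty : ∃ (_∈ tops h)
      nonempty with Peak.empty⊎top (peak h)
      ... | inj₁ (none , _) = contradiction ins none
      ... | inj₂ t = t
      r≤s : topScore g ≤ score h (toℕ j)
      r≤s = subst (_≤ score h (toℕ j)) (Peak.top-score (peak g) x∈)
        (P5⇒maximal (λ i av → let _ , _ , _ , sc = all-scored i av in _ , sc) sc p5
          (gap-scored g (All.lookup valid g∈) (Peak.top-inside (peak g) x∈)))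
      s≤ : score h (toℕ j) ≤ topScore h
      s≤ = Peak.score≤top (peak h) ins
      go : topScore h ≡ topScore g → toℕ j ∈ concatMap (topsAt (topScore g)) gs
      go eq = ∈-concatMap⁺ (topsAt (topScore g)) (lose h∈
        (subst (λ r → toℕ j ∈ topsAt r h) eq (topsAt⁺ {g = h}
          (Peak.top-complete (peak h) ins (≤-antisym s≤ (subst (_≤ score h (toℕ j)) (sym eq) r≤s))))))

    topsAt-concat-unique : ∀ r → Unique (concatMap (topsAt r) gs)
    topsAt-concat-unique r = Unique.concat⁺
      (All.map⁺ (All.universal (topsAt-unique r) gs))
      (AllPairs.map⁺ (AllPairs.map (λ {g} {h} → tops-disjoint g h) disjoint))
      where
      tops-disjoint : ∀ g h → DisjointGaps g h → Disjoint (topsAt r g) (topsAt r h)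
      tops-disjoint g h disj (x∈g , x∈h) = disj
        (Peak.top-inside (peak g) (proj₁ (topsAt⁻ {g = g} x∈g)))
        (Peak.top-inside (peak h) (proj₁ (topsAt⁻ {g = h} x∈h)))

    choices-↭ : g ∈ gs → x ∈ tops g → Best gs (topScore g) →
      map toℕ (filter (p5? (occupied js)) (allFin n)) ↭ concatMap (topsAt (topScore g)) gs
    choices-↭ {g} g∈ x∈ b = ∼bag⇒↭ (unique∧set⇒bag
      (Unique.map⁺ Fin.toℕ-injective (Unique.filter⁺ (p5? (occupied js)) (Unique.allFin⁺ n)))
      (topsAt-concat-unique (topScore g))
      (mk⇔ to from))
      where
      to : ∀ {y} → y ∈ map toℕ (filter (p5? (occupied js)) (allFin n)) →
        y ∈ concatMap (topsAt (topScore g)) gs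
      to y∈ with i , i∈ , refl ← ∈-map⁻ toℕ y∈ =
        P5⇒top g∈ x∈ b (proj₂ (∈-filter⁻ (p5? (occupied js)) {xs = allFin n} i∈))
      from : ∀ {y} → y ∈ concatMap (topsAt (topScore g)) gs →
        y ∈ map toℕ (filter (p5? (occupied js)) (allFin n))
      from y∈ with h , h∈ , y∈′ ← find (∈-concatMap⁻ (topsAt (topScore g)) {xs = gs} y∈)
        with y∈″ , eq ← topsAt⁻ {g = h} y∈′
        with i , refl ← top⇒fin h∈ y∈″ =
        ∈-map⁺ toℕ (∈-filter⁺ (p5? (occupied js)) (∈-allFin i)
          (top⇒P5 {g = h} (λ {k} k∈ z∈ → subst (topScore k ≤_) (sym eq) (b k∈ z∈)) h∈ y∈″))

  -- Weights before and after a gap is filled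

  module _ (f : ℕ → ℕ) {gs gs₀ : List Gap} {g : Gap} {x₀ : ℕ} (p : gs ↭ g ∷ gs₀) (x₀∈ : x₀ ∈ tops g)
    (f≡ : ∀ {x} → x ∈ tops g → f x ≡ weight (concatMap gapItems (split g x ++ gs₀))) where

    private
      r c w₀ k : ℕ
      r = topScore g
      c = length (tops g)
      parts : ℕ → List Item
      parts x = concatMap gapItems (split g x)
      rest : List Item
      rest = concatMap gapItems gs₀
      w₀ = weight (parts x₀ ++ rest)
      k = count r (parts x₀ ++ rest)

      items↭ : concatMap gapItems gs ↭ (r , c) ∷ parts x₀ ++ rest
      items↭ = ↭-trans (concatMap-↭ gapItems p) (Perm.++⁺ʳ rest (Peak.split-items (peak g) x₀∈))

      -- `split-items` at `x` and at `x₀` rearranges the same items with the same head; cancelling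
      -- the head compares what the two choices leave.
      f≡w₀ : ∀ {x} → x ∈ tops g → f x ≡ w₀
      f≡w₀ {x} x∈ = trans (f≡ x∈) (trans (cong weight (concatMap-++ gapItems (split g x) gs₀))
        (weight-↭ (Perm.++⁺ʳ rest (Perm.drop-∷
          (↭-trans (↭-sym (Peak.split-items (peak g) x∈)) (Peak.split-items (peak g) x₀∈))))))

    count-top : count r (concatMap gapItems gs) ≡ suc k
    count-top = trans (count-↭ r items↭) (count-accept r c (parts x₀ ++ rest))

    -- Removing the item `(r , c)` divides the weight by `c` and by the number of items of phase
    -- `r`; the sum over the `c` tops restores the first factor, the multiplication by `count r` the
    -- second.
    sum-tops : count r (concatMap gapItems gs) * sum (map f (tops g)) ≡ weight (concatMap gapItems gs)
    sum-tops = begin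
      count r (concatMap gapItems gs) * sum (map f (tops g))
        ≡⟨ cong₂ _*_ count-top (sum-map-const (All.tabulate f≡w₀)) ⟩
      suc k * (c * w₀)                ≡⟨ *-assoc (suc k) c w₀ ⟨
      suc k * c * w₀                  ≡⟨ cong (_* w₀) (*-comm (suc k) c) ⟩
      c * suc k * w₀                  ≡⟨ *-assoc c (suc k) w₀ ⟩
      c * (suc k * w₀)                ≡⟨ weight-↭ items↭ ⟨
      weight (concatMap gapItems gs)  ∎
      where open ≡-Reasoning

  count-gapItems : x ∈ tops g → count (topScore g) (gapItems g) ≡ 1
  count-gapItems {x} {g} x∈ = trans (count-↭ (topScore g) (Peak.split-items (peak g) x∈))
    (trans (count-accept (topScore g) (length (tops g)) (concatMap gapItems (split g x)))
      (cong suc (count-none (Peak.split-lower (peak g) x∈))))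

  count-gapItems-≢ : ∀ {r} → x ∈ tops g → topScore g ≤ r → topScore g ≢ r → count r (gapItems g) ≡ 0
  count-gapItems-≢ {x} {g} {r} x∈ ≤r ≢r = trans (count-↭ r (Peak.split-items (peak g) x∈))
    (trans (count-reject (length (tops g)) (concatMap gapItems (split g x)) (≢r ∘ sym))
      (count-none (All.map (λ lt → <-≤-trans lt ≤r) (Peak.split-lower (peak g) x∈))))

  sum-concatMap : ∀ {A B : Set} (f : B → ℕ) (t : A → List B) (h : A → List Item) {m r w xs} →
    All (λ x → m * sum (map f (t x)) ≡ count r (h x) * w) xs →
    m * sum (map f (concatMap t xs)) ≡ count r (concatMap h xs) * w
  sum-concatMap f t h {m} [] = *-zeroʳ m
  sum-concatMap f t h {m} {r} {w} {x ∷ xs} (e ∷ es) = begin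
    m * sum (map f (t x ++ concatMap t xs))
      ≡⟨ cong (λ l → m * sum l) (map-++ f (t x) (concatMap t xs)) ⟩
    m * sum (map f (t x) ++ map f (concatMap t xs))
      ≡⟨ cong (m *_) (sum-++ (map f (t x)) _) ⟩
    m * (sum (map f (t x)) + sum (map f (concatMap t xs)))
      ≡⟨ *-distribˡ-+ m _ _ ⟩
    m * sum (map f (t x)) + m * sum (map f (concatMap t xs))
      ≡⟨ cong₂ _+_ e (sum-concatMap f t h {m} {r} {w} es) ⟩
    count r (h x) * w + count r (concatMap h xs) * w
      ≡⟨ *-distribʳ-+ w (count r (h x)) _ ⟨
    (count r (h x) + count r (concatMap h xs)) * w
      ≡⟨ cong (_* w) (count-++ r (h x) _) ⟨
    count r (h x ++ concatMap h xs) * w ∎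
    where open ≡-Reasoning

  -- Double counting: each of the count r gaps that are filled in the current
  -- phase r accounts for the same share of the weight.
  sum-choices : ∀ (f : ℕ → ℕ) → g ∈ gs → x ∈ tops g → Best gs (topScore g) →
    (∀ {h hs y} → gs ↭ h ∷ hs → y ∈ tops h → topScore h ≡ topScore g →
      f y ≡ weight (concatMap gapItems (split h y ++ hs))) →
    sum (map f (concatMap (topsAt (topScore g)) gs)) ≡ weight (concatMap gapItems gs)
  sum-choices {g} {gs} f g∈ x∈ b f≡ with hs , p ← ∈⇒↭ g∈ =
    -- The factor `m` may be cancelled because `g` itself contributes an item of phase `r`.
    *-cancelˡ-≡ Σf w m {{>-nonZero (subst (0 <_) (sym (count-top f p x∈ (λ y∈ → f≡ p y∈ refl))) z<s)}}
      (sum-concatMap f (topsAt r) gapItems {m} {r} {w} (All.tabulate share))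
    where
    r m w Σf : ℕ
    r = topScore g
    m = count r (concatMap gapItems gs)
    w = weight (concatMap gapItems gs)
    Σf = sum (map f (concatMap (topsAt r) gs))
    share : ∀ {h} → h ∈ gs →
      m * sum (map f (topsAt r h)) ≡ count r (gapItems h) * w
    share {h} h∈ with Peak.empty⊎top (peak h) | topScore h ≟ r
    -- An empty gap has `topScore` 0 and so seems to join the phase of the sandwiched payphones, but
    -- it has neither tops nor items.
    ... | inj₁ (_ , t≡ , i≡) | yes _ rewrite t≡ | i≡ = *-zeroʳ m
    ... | inj₁ (_ , t≡ , i≡) | no _ rewrite i≡ = *-zeroʳ m
    ... | inj₂ (y , y∈) | no ne = trans (*-zeroʳ m)
      (cong (_* w) (sym (count-gapItems-≢ {g = h} y∈ (b h∈ y∈) ne)))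
    ... | inj₂ (y , y∈) | yes eq with hs , p ← ∈⇒↭ h∈ = begin
      m * sum (map f (tops h))
        ≡⟨ cong (λ s → count s (concatMap gapItems gs) * sum (map f (tops h))) eq ⟨
      count (topScore h) (concatMap gapItems gs) * sum (map f (tops h))
        ≡⟨ sum-tops f p y∈ (λ y∈ → f≡ p y∈ eq) ⟩
      w
        ≡⟨ *-identityˡ w ⟨
      1 * w
        ≡⟨ cong (_* w) (trans (cong (λ s → count s (gapItems h)) (sym eq)) (count-gapItems {g = h} y∈)) ⟨
      count r (gapItems h) * w ∎
      where open ≡-Reasoning

  -- Counting completions by induction

  occupied-≤ : Unique js → length js ≤ n
  occupied-≤ u = Fin.injective⇒≤ (lookup-injective u)

  -- Gaps list their tops as natural numbers, so the number of extensions is made a function on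
  -- these, with value 0 beyond the row.
  extensionsAt : List (Fin n) → ℕ → ℕ
  extensionsAt js x with x <? n
  ... | yes x<n = extensions (fromℕ< x<n ∷ js)
  ... | no  _   = 0

  extensionsAt-toℕ : ∀ js j → extensionsAt js (toℕ j) ≡ extensions (j ∷ js)
  extensionsAt-toℕ js j with toℕ j <? n
  ... | yes j<n = cong (λ i → extensions (i ∷ js)) (Fin.fromℕ<-toℕ j j<n)
  ... | no  j≮n = contradiction (Fin.toℕ<n j) j≮n

  -- Induction on a bound `k` for the number of persons still to come; at `k = 0` a free payphone
  -- together with `js` would give more than `n` distinct payphones. As `js` is nonempty, the next
  -- person is bound by the rule.
  extensions≡weight : ∀ k → n ≤ length js + k → 0 < length js → Chain js → Decomposition js gs →
    extensions js ≡ weight (concatMap gapItems gs)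
  extensions≡weight {js} {gs} k n≤ 0<js chain d with best gs
  ... | inj₁ es = trans (extensions-complete chain full) (sym (cong weight (no-items es)))
    where
    open Decomposition d
    open import Data.List.Membership.DecPropositional (Fin._≟_ {n}) using (_∈?_)
    full : ∀ i → i ∈ js
    full i with i ∈? js
    ... | yes i∈ = i∈
    ... | no i∉ with g , g∈ , ins ← cover i∉ = contradiction ins (proj₁ (All.lookup es g∈))
    no-items : ∀ {gs} → All EmptyGap gs → concatMap gapItems gs ≡ []
    no-items [] = refl
    no-items ((_ , _ , e) ∷ es) = cong₂ _++_ e (no-items es)
  ... | inj₂ (g , g∈ , (x , x∈) , b) with i , refl ← top⇒fin d g∈ x∈ = by-fuel k n≤
    where
    open Decomposition d
    open ≡-Reasoning
    i∉ : i ∉ js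
    i∉ = proj₂ (All.lookup valid g∈) (Peak.top-inside (peak g) x∈)
    L : List (Fin n)
    L = filter (p5? (occupied js)) (allFin n)
    by-fuel : ∀ k → n ≤ length js + k → extensions js ≡ weight (concatMap gapItems gs)
    by-fuel zero n≤ = contradiction
      (≤-trans (occupied-≤ (All.¬Any⇒All¬ _ i∉ ∷ chain-unique chain)) (subst (n ≤_) (+-identityʳ _) n≤))
      1+n≰n
    by-fuel (suc k) n≤ = begin
      extensions js
        ≡⟨ extensions-step (Unique.filter⁺ (p5? (occupied js)) (Unique.allFin⁺ n)) i∉
             (λ {j} e → ∈-filter⁺ (p5? (occupied js)) (∈-allFin j) (extension-P5 0<js e)) ⟩
      sum (map (λ j → extensions (j ∷ js)) L)
        ≡⟨ cong sum (map-cong (λ j → sym (extensionsAt-toℕ js j)) L) ⟩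
      sum (map (extensionsAt js ∘ toℕ) L)
        ≡⟨ cong sum (map-∘ {g = extensionsAt js} {f = toℕ} L) ⟩
      sum (map (extensionsAt js) (map toℕ L))
        ≡⟨ sum-↭ (Perm.map⁺ (extensionsAt js) (choices-↭ d g∈ x∈ b)) ⟩
      sum (map (extensionsAt js) (concatMap (topsAt (topScore g)) gs))
        ≡⟨ sum-choices (extensionsAt js) g∈ x∈ b next-gap ⟩
      weight (concatMap gapItems gs) ∎
      where
      next-gap : ∀ {h hs y} → gs ↭ h ∷ hs → y ∈ tops h → topScore h ≡ topScore g →
        extensionsAt js y ≡ weight (concatMap gapItems (split h y ++ hs))
      next-gap {h} p y∈ eq with h∈ ← Perm.∈-resp-↭ (↭-sym p) (here refl)
        with j , refl ← top⇒fin d h∈ y∈ = trans (extensionsAt-toℕ js j)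
          (extensions≡weight k (subst (n ≤_) (+-suc (length js) k) n≤) z<s
            (next (top⇒P5 d {g = h} (λ {k} k∈ z∈ → subst (topScore k ≤_) (sym eq) (b k∈ z∈)) h∈ y∈) chain)
            (decomposition-split (Peak.top-inside (peak h) y∈) (decomposition-↭ p d)))

-- The weight of a multiset of labels

indicator-yes : ∀ {P : Set} (p? : Dec P) → P → indicator p? ≡ 1
indicator-yes (yes _) _ = refl
indicator-yes (no ¬p) p = contradiction p ¬p

indicator-no : ∀ {P : Set} (p? : Dec P) → ¬ P → indicator p? ≡ 0
indicator-no (yes p) ¬p = contradiction p ¬p
indicator-no (no _)  _  = refl

double≡ : ∀ j → 2 * suc j ≡ suc (suc (j + j))
double≡ = solve-∀

pred-double≡ : ∀ j → 2 * suc j ∸ 1 ≡ suc (j + j)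
pred-double≡ j = cong (_∸ 1) (double≡ j)

-- The odd labels start at 3: the label 1 has phase 0 and forms a class of its own.
data Label : ℕ → Set where
  one  : Label 1
  even : ∀ j → Label (2 * suc j)
  odd  : ∀ j → Label (2 * suc (suc j) ∸ 1)

label : ∀ {l} → 0 < l → Label l
label {1}                 _ = one
label {2}                 _ = even 0
label {suc (suc (suc l))} _ with label {suc l} z<s
... | one    = odd 0
... | even j = subst Label (shift j) (even (suc j))
  where
  shift : ∀ j → 2 * suc (suc j) ≡ suc (suc (2 * suc j))
  shift = solve-∀
... | odd j  = subst Label (cong (_∸ 1) (shift j)) (odd (suc j))
  where
  shift : ∀ j → 2 * suc (suc (suc j)) ≡ suc (suc (2 * suc (suc j)))
  shift = solve-∀

phase-even : ∀ j → phase (2 * suc j) ≡ suc j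
phase-even j = trans (cong phase (double≡ j)) (cong suc (sym (n≡⌈n+n/2⌉ j)))

phase-odd : ∀ j → phase (2 * suc (suc j) ∸ 1) ≡ suc (suc j)
phase-odd j = trans (cong phase (pred-double≡ (suc j))) (cong suc (sym (n≡⌊n+n/2⌋ (suc j))))

choices-even : ∀ j → choices (2 * suc j) ≡ 2
choices-even j = trans (cong choices (double≡ j)) two
  where
  two : choices (suc (suc (j + j))) ≡ 2
  two with balanced? (suc (j + j))
  ... | yes e = contradiction (trans (n≡⌈n+n/2⌉ j) (trans e (cong suc (sym (n≡⌊n+n/2⌋ j))))) (<⇒≢ (n<1+n j))
  ... | no _  = refl

choices-odd : ∀ j → choices (2 * suc j ∸ 1) ≡ 1
choices-odd j = trans (cong choices (pred-double≡ j)) single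
  where
  single : choices (suc (j + j)) ≡ 1
  single with balanced? (j + j)
  ... | yes _ = refl
  ... | no ne = contradiction (trans (sym (n≡⌊n+n/2⌋ j)) (n≡⌈n+n/2⌉ j)) ne

mult-∷ : ∀ k l M → mult k (l ∷ M) ≡ indicator (k ≟ l) + mult k M
mult-∷ k = length-filter-∷ (k ≟_)

2*-injective : ∀ {j k} → 2 * j ≡ 2 * k → j ≡ k
2*-injective {j} {k} = *-cancelˡ-≡ j k 2

odd≢even : ∀ j k → 2 * suc j ∸ 1 ≢ 2 * suc k
odd≢even zero    k       eq = contradiction (trans eq (double≡ k)) λ ()
odd≢even (suc j) k eq
  -- Comparing phases forces equal indices, so that a positive number would equal its predecessor.
  with refl ← trans (sym (phase-odd j)) (trans (cong phase eq) (phase-even k)) =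
  <⇒≢ (≤-reflexive (suc-pred (2 * suc (suc j)))) eq

-- For `r ≥ 2` the labels of phase `r` are `2r` and `2r - 1`. At `r = 1` the label 1 drops out,
-- which is why `H` has separate factorials for 2 and 1.
mult-phase : ∀ k {M} → All (0 <_) M →
  mult (2 * suc (suc k)) M + mult (2 * suc (suc k) ∸ 1) M ≡ count (suc (suc k)) (map item M)
mult-phase k [] = refl
mult-phase k {l ∷ M} (0<l ∷ pos) = begin
  mult e (l ∷ M) + mult o (l ∷ M)
    ≡⟨ cong₂ _+_ (mult-∷ e l M) (mult-∷ o l M) ⟩
  (indicator (e ≟ l) + mult e M) + (indicator (o ≟ l) + mult o M)
    ≡⟨ interchange +-commutativeSemigroup (indicator (e ≟ l)) _ _ _ ⟩
  (indicator (e ≟ l) + indicator (o ≟ l)) + (mult e M + mult o M)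
    ≡⟨ cong₂ _+_ (member (label 0<l)) (mult-phase k pos) ⟩
  indicator (r ≟ phase l) + count r (map item M)
    ≡⟨ length-filter-∷ (λ x → r ≟ proj₁ x) (item l) (map item M) ⟨
  count r (map item (l ∷ M)) ∎
  where
  open ≡-Reasoning
  r e o : ℕ
  r = suc (suc k)
  e = 2 * r
  o = 2 * r ∸ 1
  member : ∀ {l} → Label l → indicator (e ≟ l) + indicator (o ≟ l) ≡ indicator (r ≟ phase l)
  member one = cong₂ _+_
    (indicator-no (e ≟ 1) λ eq → contradiction (trans (sym (double≡ (suc k))) eq) λ ())
    (indicator-no (o ≟ 1) λ eq → contradiction (trans (sym (pred-double≡ (suc k))) eq) λ ())
  member (even j) with r ≟ suc j
  ... | yes refl = trans
    (cong₂ _+_ (indicator-yes (e ≟ e) refl) (indicator-no (o ≟ e) (odd≢even (suc k) (suc k))))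
    (sym (indicator-yes (r ≟ phase e) (sym (phase-even (suc k)))))
  ... | no r≢ = trans (cong₂ _+_ (indicator-no (e ≟ 2 * suc j) (r≢ ∘ 2*-injective))
      (indicator-no (o ≟ 2 * suc j) (odd≢even (suc k) j)))
    (sym (indicator-no (r ≟ phase (2 * suc j)) λ eq → r≢ (trans eq (phase-even j))))
  member (odd j) with r ≟ suc (suc j)
  ... | yes refl = trans
    (cong₂ _+_ (indicator-no (e ≟ o) (odd≢even (suc k) (suc k) ∘ sym)) (indicator-yes (o ≟ o) refl))
    (sym (indicator-yes (r ≟ phase o) (sym (phase-odd k))))
  ... | no r≢ = trans (cong₂ _+_ (indicator-no (e ≟ l′) (odd≢even (suc j) (suc k) ∘ sym))
      (indicator-no (o ≟ l′) λ eq → r≢ (trans (sym (phase-odd k)) (trans (cong phase eq) (phase-odd j)))))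
    (sym (indicator-no (r ≟ phase l′) λ eq → r≢ (trans eq (phase-odd j))))
    where l′ = 2 * suc (suc j) ∸ 1

mult-single : ∀ {k r M} → (∀ {l} → 0 < l → k ≡ l → r ≡ phase l) → (∀ {l} → 0 < l → r ≡ phase l → k ≡ l) →
  All (0 <_) M → mult k M ≡ count r (map item M)
mult-single to from [] = refl
mult-single {k} {r} {l ∷ M} to from (0<l ∷ pos) = begin
  mult k (l ∷ M)                                  ≡⟨ mult-∷ k l M ⟩
  indicator (k ≟ l) + mult k M                    ≡⟨ cong₂ _+_ same (mult-single to from pos) ⟩
  indicator (r ≟ phase l) + count r (map item M)
    ≡⟨ length-filter-∷ (λ x → r ≟ proj₁ x) (item l) (map item M) ⟨
  count r (map item (l ∷ M))                      ∎
  where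
  open ≡-Reasoning
  same : indicator (k ≟ l) ≡ indicator (r ≟ phase l)
  same with k ≟ l
  ... | yes k≡l = sym (indicator-yes (r ≟ phase l) (to 0<l k≡l))
  ... | no k≢l  = sym (indicator-no (r ≟ phase l) (k≢l ∘ from 0<l))

mult-1 : ∀ {M} → All (0 <_) M → mult 1 M ≡ count 0 (map item M)
mult-1 = mult-single (λ { _ refl → refl }) from
  where
  from : ∀ {l} → 0 < l → 0 ≡ phase l → 1 ≡ l
  from {1}           _ _ = refl
  from {suc (suc _)} _ ()

mult-2 : ∀ {M} → All (0 <_) M → mult 2 M ≡ count 1 (map item M)
mult-2 = mult-single (λ { _ refl → refl }) from
  where
  from : ∀ {l} → 0 < l → 1 ≡ phase l → 2 ≡ l
  from {2}                 _ _ = refl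
  from {suc (suc (suc _))} _ ()

-- `H` as the weight of the items of its labels

∏-cong : ∀ {f g : ℕ → ℕ} ks → (∀ {k} → k ∈ ks → f k ≡ g k) → ∏ ks f ≡ ∏ ks g
∏-cong _ eq = cong product (map-cong-local (All.tabulate eq))

∑-cong : ∀ {f g : ℕ → ℕ} ks → (∀ {k} → k ∈ ks → f k ≡ g k) → ∑ ks f ≡ ∑ ks g
∑-cong _ eq = cong sum (map-cong-local (All.tabulate eq))

∏-update : ∀ {f g : ℕ → ℕ} {r c ks} → Unique ks → r ∈ ks → f r ≡ c * g r →
  (∀ {k} → r ≢ k → f k ≡ g k) → ∏ ks f ≡ c * ∏ ks g
∏-update {f} {g} {r} {c} {_ ∷ ks} (r∉ ∷ _) (here refl) fr other = begin
  f r * ∏ ks f        ≡⟨ cong₂ _*_ fr (∏-cong ks (λ k∈ → other (All.lookup r∉ k∈))) ⟩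
  c * g r * ∏ ks g    ≡⟨ *-assoc c (g r) _ ⟩
  c * (g r * ∏ ks g)  ∎
  where open ≡-Reasoning
∏-update {f} {g} {r} {c} {j ∷ ks} (j∉ ∷ u) (there r∈) fr other = begin
  f j * ∏ ks f        ≡⟨ cong₂ _*_ (other (λ r≡j → All.lookup j∉ r∈ (sym r≡j)))
                            (∏-update {c = c} u r∈ fr other) ⟩
  g j * (c * ∏ ks g)  ≡⟨ rearrange (g j) c (∏ ks g) ⟩
  c * (g j * ∏ ks g)  ∎
  where
  open ≡-Reasoning
  rearrange : ∀ x y z → x * (y * z) ≡ y * (x * z)
  rearrange = solve-∀

∑-suc : ∀ {f g : ℕ → ℕ} {r ks} → Unique ks → r ∈ ks → f r ≡ suc (g r) →
  (∀ {k} → r ≢ k → f k ≡ g k) → ∑ ks f ≡ suc (∑ ks g)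
∑-suc {ks = _ ∷ ks} (r∉ ∷ _) (here refl) fr other =
  cong₂ _+_ fr (∑-cong ks (λ k∈ → other (All.lookup r∉ k∈)))
∑-suc {f} {g} {r} {j ∷ ks} (j∉ ∷ u) (there r∈) fr other =
  trans (cong₂ _+_ (other (λ r≡j → All.lookup j∉ r∈ (sym r≡j))) (∑-suc u r∈ fr other)) (+-suc (g j) _)

weight≡∏ : ∀ {ks} → Unique ks → ∀ {xs} → All (λ x → proj₁ x ∈ ks) xs →
  weight xs ≡ ∏ ks (λ k → (count k xs) !) * product (map proj₂ xs)
weight≡∏ {ks} u [] = sym (trans (*-identityʳ _) (ones ks))
  where
  ones : ∀ ks → ∏ ks (λ _ → 1) ≡ 1
  ones []       = refl
  ones (_ ∷ ks) = trans (*-identityˡ _) (ones ks)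
weight≡∏ {ks} u {(r , c) ∷ xs} (r∈ ∷ all) = begin
  c * (suc (count r xs) * weight xs)
    ≡⟨ cong (λ w → c * (suc (count r xs) * w)) (weight≡∏ u all) ⟩
  c * (suc (count r xs) * (∏ ks (λ k → (count k xs) !) * p))
    ≡⟨ rearrange c (suc (count r xs)) (∏ ks (λ k → (count k xs) !)) p ⟩
  suc (count r xs) * ∏ ks (λ k → (count k xs) !) * (c * p)
    ≡⟨ cong (_* (c * p)) (∏-update {c = suc (count r xs)} u r∈ (cong _! (count-accept r c xs))
         (λ r≢k → cong _! (count-reject c xs (r≢k ∘ sym)))) ⟨
  ∏ ks (λ k → (count k ((r , c) ∷ xs)) !) * (c * p) ∎
  where
  open ≡-Reasoning
  p = product (map proj₂ xs)
  rearrange : ∀ c s w p → c * (s * (w * p)) ≡ s * w * (c * p)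
  rearrange = solve-∀

∈-range⁺ : ∀ {a b k} → a ≤ k → k ≤ b → k ∈ [ a ⋯ b ]
∈-range⁺ {a} {b} a≤k k≤b with i , refl ← m≤n⇒∃[o]m+o≡n a≤k =
  ∈-applyUpTo⁺ (a +_) (+-cancelˡ-< a i _ (subst (a + i <_)
    (sym (m+[n∸m]≡n (≤-trans (m≤m+n a i) (≤-trans k≤b (n≤1+n b))))) (s≤s k≤b)))

∈-range⁻ : ∀ a b {k} → k ∈ [ a ⋯ b ] → a ≤ k
∈-range⁻ a b k∈ with i , _ , refl ← ∈-applyUpTo⁻ (a +_) k∈ = m≤m+n a i

range-unique : ∀ a b → Unique [ a ⋯ b ]
range-unique a b = Unique.applyUpTo⁺₁ (a +_) (suc b ∸ a) λ i<j _ eq → <⇒≢ i<j (+-cancelˡ-≡ a _ _ eq)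

2^∑≡∏choices : ∀ {K M} → All (0 <_) M → All (_≤ K) M →
  2 ^ ∑ [ 1 ⋯ K ] (λ k → mult (2 * k) M) ≡ product (map proj₂ (map item M))
2^∑≡∏choices {K} [] [] = cong (2 ^_) (zeros [ 1 ⋯ K ])
  where
  zeros : ∀ ks → ∑ ks (λ _ → 0) ≡ 0
  zeros []       = refl
  zeros (_ ∷ ks) = zeros ks
2^∑≡∏choices {K} {l ∷ M} (0<l ∷ pos) (l≤K ∷ bounded) =
  trans (by-label (label 0<l) l≤K) (cong (choices l *_) (2^∑≡∏choices pos bounded))
  where
  Σ∷ : ℕ → ℕ
  Σ∷ l = ∑ [ 1 ⋯ K ] (λ k → mult (2 * k) (l ∷ M))
  ΣM : ℕ
  ΣM = ∑ [ 1 ⋯ K ] (λ k → mult (2 * k) M)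
  odd-case : ∀ {l} → choices l ≡ 1 → (∀ {k} → 2 * suc k ≢ l) → 2 ^ Σ∷ l ≡ choices l * 2 ^ ΣM
  odd-case {l} c≡1 ≢l = trans
    (cong (2 ^_) (∑-cong [ 1 ⋯ K ] λ k∈ → same (∈-range⁻ 1 K k∈)))
    (sym (trans (cong (_* 2 ^ ΣM) c≡1) (*-identityˡ _)))
    where
    same : ∀ {k} → 1 ≤ k → mult (2 * k) (l ∷ M) ≡ mult (2 * k) M
    same {suc k} _ = trans (mult-∷ (2 * suc k) l M)
      (cong (_+ mult (2 * suc k) M) (indicator-no (2 * suc k ≟ l) ≢l))
  by-label : ∀ {l} → Label l → l ≤ K → 2 ^ Σ∷ l ≡ choices l * 2 ^ ΣM
  by-label one _ = odd-case refl λ {k} eq → contradiction (trans (sym (double≡ k)) eq) λ ()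
  by-label (odd j) _ = odd-case (choices-odd (suc j)) λ {k} eq → odd≢even (suc j) k (sym eq)
  -- An even label raises the one summand at `suc j`, which lies in the range since
  -- `suc j ≤ 2 * suc j ≤ K`.
  by-label (even j) l≤K = trans
    (cong (2 ^_) (∑-suc (range-unique 1 K) (∈-range⁺ (s≤s z≤n) (≤-trans (m≤m+n (suc j) _) l≤K))
      (trans (mult-∷ l′ l′ M) (cong (_+ mult l′ M) (indicator-yes (l′ ≟ l′) refl)))
      (λ {k} j≢k → trans (mult-∷ (2 * k) l′ M)
        (cong (_+ mult (2 * k) M) (indicator-no (2 * k ≟ l′) (j≢k ∘ sym ∘ 2*-injective))))))
    (cong (_* 2 ^ ΣM) (sym (choices-even j)))
    where l′ = 2 * suc j

H≡weight : ∀ {M} → All (0 <_) M → H M ≡ weight (map item M)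
H≡weight {M} pos = begin
  ∏ [ 2 ⋯ K ] (λ k → (mult (2 * k) M + mult (2 * k ∸ 1) M) !)
      * (mult 2 M) ! * (mult 1 M) ! * 2 ^ ∑ [ 1 ⋯ K ] (λ k → mult (2 * k) M)
    ≡⟨ cong₂ _*_ (cong₂ _*_ (cong₂ _*_ (∏-cong [ 2 ⋯ K ] (λ k∈ → classes (∈-range⁻ 2 K k∈)))
         (cong _! (mult-2 pos))) (cong _! (mult-1 pos))) (2^∑≡∏choices pos bounded) ⟩
  ∏ [ 2 ⋯ K ] f * f 1 * f 0 * p
    ≡⟨ rearrange (∏ [ 2 ⋯ K ] f) (f 1) (f 0) p ⟩
  -- The factorials for the labels 1 and 2 are the factors of the phases 0 and 1; no phase exceeds
  -- `K`, since a phase is at most its label.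
  ∏ (0 ∷ 1 ∷ [ 2 ⋯ K ]) f * p
    ≡⟨ weight≡∏ unique (All.map⁺ (All.map (λ {l} → phase-∈ l) bounded)) ⟨
  weight (map item M) ∎
  where
  open ≡-Reasoning
  K p : ℕ
  K = maximum M
  p = product (map proj₂ (map item M))
  f : ℕ → ℕ
  f k = (count k (map item M)) !
  bounded : All (_≤ K) M
  bounded = Extrema.xs≤max 0 M
  classes : ∀ {k} → 2 ≤ k → (mult (2 * k) M + mult (2 * k ∸ 1) M) ! ≡ f k
  classes (s≤s (s≤s {n = k} _)) = cong _! (mult-phase k pos)
  rearrange : ∀ a b c d → a * b * c * d ≡ c * (b * a) * d
  rearrange = solve-∀
  unique : Unique (0 ∷ 1 ∷ [ 2 ⋯ K ])
  unique = ((λ ()) ∷ All.tabulate (λ k∈ → <⇒≢ (≤-trans (s≤s z≤n) (∈-range⁻ 2 K k∈))))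
    ∷ All.tabulate (λ k∈ → <⇒≢ (∈-range⁻ 2 K k∈)) ∷ range-unique 2 K
  phase-∈ : ∀ l → l ≤ K → phase l ∈ 0 ∷ 1 ∷ [ 2 ⋯ K ]
  phase-∈ l l≤K with phase l | phase≤ l
  ... | 0             | _ = here refl
  ... | 1             | _ = there (here refl)
  ... | suc (suc r)   | r≤l = there (there (∈-range⁺ (s≤s (s≤s z≤n)) (≤-trans r≤l l≤K)))

-- The choice of the first person

initial-decomposition : ∀ {n} (j : Fin n) → Decomposition [ j ] (left (toℕ j) ∷ right (toℕ j) n ∷ [])
initial-decomposition {n} j = record
  { cover    = cover
  ; valid    = ((j , here refl , refl) , λ { i<j (here refl) → <-irrefl refl i<j })
             ∷ (((j , here refl , refl) , refl) , λ { (j<i , _) (here refl) → <-irrefl refl j<i }) ∷ []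
  ; disjoint = ((λ x<j (j<x , _) → <-asym x<j j<x) ∷ []) ∷ [] ∷ []
  }
  where
  cover : ∀ {i} → i ∉ [ j ] → ∃ λ g → g ∈ left (toℕ j) ∷ right (toℕ j) n ∷ [] × Inside g (toℕ i)
  cover {i} i∉ with <-cmp (toℕ i) (toℕ j)
  ... | tri< i<j _ _ = _ , here refl , i<j
  ... | tri≈ _ i≡j _ = contradiction (here (Fin.toℕ-injective i≡j)) i∉
  ... | tri> _ _ j<i = _ , there (here refl) , j<i , Fin.toℕ<n i

sides : ℕ → ℕ → ℕ
sides a b = weight (endItems a ++ endItems b)

tabulate≡applyUpTo : ∀ {A : Set} n (f : ℕ → A) → tabulate {n = n} (f ∘ toℕ) ≡ applyUpTo f n
tabulate≡applyUpTo zero    f = refl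
tabulate≡applyUpTo (suc n) f = cong (f 0 ∷_) (tabulate≡applyUpTo n (f ∘ suc))

-- The first person may take any payphone; `x` is the number of payphones to its left, which makes
-- two end gaps of lengths `x` and `n ∸ x`.
P₅≡sum-sides : ∀ n → P₅ (suc n) ≡ sum (applyUpTo (λ x → sides x (n ∸ x)) (suc n))
P₅≡sum-sides n = begin
  P₅ (suc n)
    ≡⟨ cong length (filter-≐ isPayphonePermutation₅? (extends? {suc n} [])
         ((λ l → l , tt) , proj₁) (assignments (suc n))) ⟩
  extensions {suc n} []
    ≡⟨ extensions-step {i = Fin.zero} {js = []} (Unique.allFin⁺ (suc n)) (λ ()) (λ {j} _ → ∈-allFin j) ⟩
  sum (map (λ j → extensions [ j ]) (allFin (suc n)))
    ≡⟨ cong sum (map-cong first (allFin (suc n))) ⟩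
  sum (map (λ j → sides (toℕ j) (n ∸ toℕ j)) (allFin (suc n)))
    ≡⟨ cong sum (map-tabulate {n = suc n} id (λ j → sides (toℕ j) (n ∸ toℕ j))) ⟩
  sum (tabulate {n = suc n} (λ j → sides (toℕ j) (n ∸ toℕ j)))
    ≡⟨ cong sum (tabulate≡applyUpTo (suc n) (λ x → sides x (n ∸ x))) ⟩
  sum (applyUpTo (λ x → sides x (n ∸ x)) (suc n)) ∎
  where
  open ≡-Reasoning
  first : ∀ j → extensions [ j ] ≡ sides (toℕ j) (n ∸ toℕ j)
  first j = trans (extensions≡weight n ≤-refl z<s (start j) (initial-decomposition j))
    (cong (λ xs → weight (endItems (toℕ j) ++ xs)) (++-identityʳ _))

-- End gaps and the multisets `S′`

S-positive : ∀ n → All (0 <_) (S n)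
S-positive n = go n (<-wellFounded n)
  where
  go : ∀ n (a : Acc _<_ n) → All (0 <_) (S-acc n a)
  go zero    _        = []
  go (suc m) (acc rs) = z<s ∷ All.++⁺ (go ⌊ m /2⌋ _) (go ⌈ m /2⌉ _)

S′-positive : ∀ l → All (0 <_) (S′ l)
S′-positive zero    = []
S′-positive (suc l) = All.++⁺ (S-positive l) (subst (0 <_) (sym (pred-double≡ l)) z<s ∷ [])

-- An end gap of length `e ≥ 2` imitates a middle gap of length `2e - 1`: phase `e`, one choice. At
-- `e = 1` the phases would be 1 and 0.
S′-items : ∀ l → map item (S′ (suc (suc l))) ↭ endItems (suc (suc l))
S′-items l = ↭-trans (↭-reflexive (map-++ item (S (suc l)) [ 2 * suc (suc l) ∸ 1 ]))
  (↭-trans (Perm.++-comm (items (suc l)) _)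
    (↭-reflexive (cong (_∷ items (suc l)) (cong₂ _,_ (phase-odd l) (choices-odd (suc l))))))

H-S′ : ∀ l → H (S′ (suc (suc l))) ≡ weight (endItems (suc (suc l)))
H-S′ l = trans (H≡weight (S′-positive (suc (suc l)))) (weight-↭ (S′-items l))

-- The label 2 gives the item `(1 , 2)`, an end gap of length 1 the item `(1 , 1)`; hence the factor
-- 2.
H-2∷ : ∀ {M xs} → All (0 <_) M → map item M ↭ xs → H (2 ∷ M) ≡ 2 * weight (endItems 1 ++ xs)
H-2∷ {M} {xs} pos p = trans (H≡weight (z<s ∷ pos))
  (trans (weight-↭ (↭-prep (1 , 2) p)) (cong (2 *_) (sym (*-identityˡ (suc (count 1 xs) * weight xs)))))

H-++ : ∀ {M N xs ys} → All (0 <_) M → All (0 <_) N → map item M ↭ xs → map item N ↭ ys →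
  H (M ++ N) ≡ weight (xs ++ ys)
H-++ {M} {N} posM posN p q = trans (H≡weight (All.++⁺ posM posN))
  (weight-↭ (↭-trans (↭-reflexive (map-++ item M N)) (Perm.++⁺ p q)))

H-2∪S′ : ∀ l → H ([ 2 ] ++ S′ (suc (suc l))) ≡ 2 * sides 1 (suc (suc l))
H-2∪S′ l = H-2∷ (S′-positive (suc (suc l))) (S′-items l)

H-S′∪S′ : ∀ k l → H (S′ (suc (suc k)) ++ S′ (suc (suc l))) ≡ sides (suc (suc k)) (suc (suc l))
H-S′∪S′ k l = H-++ (S′-positive (suc (suc k))) (S′-positive (suc (suc l))) (S′-items k) (S′-items l)

sides-comm : ∀ a b → sides a b ≡ sides b a
sides-comm a b = weight-↭ (Perm.++-comm (endItems a) (endItems b))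

-- Regrouping the sum over the first person

sum-∷ʳ : ∀ xs x → sum (xs ∷ʳ x) ≡ sum xs + x
sum-∷ʳ xs x = trans (sum-++ xs [ x ]) (cong (sum xs +_) (+-identityʳ x))

sum-ends : ∀ (f : ℕ → ℕ) q → f (3 + q) ≡ f 0 → f (2 + q) ≡ f 1 →
  sum (applyUpTo f (4 + q)) ≡ 2 * f 0 + 2 * f 1 + sum (applyUpTo (f ∘ (2 +_)) q)
sum-ends f q last penultimate = begin
  f 0 + (f 1 + sum (applyUpTo g (2 + q)))
    ≡⟨ cong (λ xs → f 0 + (f 1 + sum xs)) (applyUpTo-∷ʳ g (1 + q)) ⟨
  f 0 + (f 1 + sum (applyUpTo g (1 + q) ∷ʳ f (3 + q)))
    ≡⟨ cong (λ s → f 0 + (f 1 + s)) (sum-∷ʳ (applyUpTo g (1 + q)) (f (3 + q))) ⟩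
  f 0 + (f 1 + (sum (applyUpTo g (1 + q)) + f (3 + q)))
    ≡⟨ cong (λ xs → f 0 + (f 1 + (sum xs + f (3 + q)))) (applyUpTo-∷ʳ g q) ⟨
  f 0 + (f 1 + (sum (applyUpTo g q ∷ʳ f (2 + q)) + f (3 + q)))
    ≡⟨ cong (λ s → f 0 + (f 1 + (s + f (3 + q)))) (sum-∷ʳ (applyUpTo g q) (f (2 + q))) ⟩
  f 0 + (f 1 + (sum (applyUpTo g q) + f (2 + q) + f (3 + q)))
    ≡⟨ cong₂ (λ u v → f 0 + (f 1 + (sum (applyUpTo g q) + u + v))) penultimate last ⟩
  f 0 + (f 1 + (sum (applyUpTo g q) + f 1 + f 0))
    ≡⟨ rearrange (f 0) (f 1) (sum (applyUpTo g q)) ⟩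
  2 * f 0 + 2 * f 1 + sum (applyUpTo g q) ∎
  where
  open ≡-Reasoning
  g : ℕ → ℕ
  g = f ∘ (2 +_)
  rearrange : ∀ a b c → a + (b + (c + b + a)) ≡ 2 * a + 2 * b + c
  rearrange = solve-∀

-- The index `i` of the theorem numbers payphones from 1 and is thus one more than the number of
-- payphones to the left.
sum-shift : ∀ (f h : ℕ → ℕ) q → (∀ {x} → x < q → f (2 + x) ≡ h (3 + x)) →
  sum (applyUpTo (f ∘ (2 +_)) q) ≡ sum (map h (applyUpTo (3 +_) q))
sum-shift f h q eq = begin
  sum (applyUpTo (f ∘ (2 +_)) q)        ≡⟨ cong sum (map-applyUpTo id (f ∘ (2 +_)) q) ⟨
  sum (map (f ∘ (2 +_)) (upTo q))       ≡⟨ ∑-cong (upTo q) pointwise ⟩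
  sum (map (h ∘ (3 +_)) (upTo q))       ≡⟨ cong sum (map-applyUpTo id (h ∘ (3 +_)) q) ⟩
  sum (applyUpTo (h ∘ (3 +_)) q)        ≡⟨ cong sum (map-applyUpTo (3 +_) h q) ⟨
  sum (map h (applyUpTo (3 +_) q))      ∎
  where
  open ≡-Reasoning
  pointwise : ∀ {x} → x ∈ upTo q → f (2 + x) ≡ h (3 + x)
  pointwise x∈ with x , x<q , refl ← ∈-applyUpTo⁻ id x∈ = eq x<q

sides≡H : ∀ q {x} → x < q → sides (2 + x) (3 + q ∸ (2 + x)) ≡ H (S′ (2 + x) ++ S′ (4 + q ∸ (3 + x)))
sides≡H q {x} x<q = via (m<n⇒suc q x<q)
  where
  -- At least two payphones remain on the right, as the passage from an end gap to `S′` requires.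
  m<n⇒suc : ∀ q {x} → x < q → ∃ λ k → suc q ∸ x ≡ suc (suc k)
  m<n⇒suc (suc q) {zero}  _         = q , refl
  m<n⇒suc (suc q) {suc x} (s≤s x<q) = m<n⇒suc q x<q
  via : ∀ {l} → (∃ λ k → l ≡ suc (suc k)) → sides (2 + x) l ≡ H (S′ (2 + x) ++ S′ l)
  via (k , refl) = sym (H-S′∪S′ x k)

P₅-recurrence : ∀ q → P₅ (4 + q) ≡ 2 * H (S′ (3 + q)) + H ([ 2 ] ++ S′ (2 + q))
  + ∑ [ 3 ⋯ 2 + q ] (λ i → H (S′ (i ∸ 1) ++ S′ (4 + q ∸ i)))
P₅-recurrence q = trans (P₅≡sum-sides (3 + q)) (trans (sum-ends f q last penultimate)
  (cong₂ _+_ (cong₂ _+_ (cong (2 *_) (sym (H-S′ (suc q)))) (sym (H-2∪S′ q)))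
    (sum-shift f (λ i → H (S′ (i ∸ 1) ++ S′ (4 + q ∸ i))) q (sides≡H q))))
  where
  f : ℕ → ℕ
  f x = sides x (3 + q ∸ x)
  penultimate : f (2 + q) ≡ f 1
  penultimate = trans (cong (sides (2 + q)) (m+n∸n≡m 1 q)) (sides-comm (2 + q) 1)
  last : f (3 + q) ≡ f 0
  last = trans (cong (sides (3 + q)) (n∸n≡0 q)) (sides-comm (3 + q) 0)

theorem8 : P₅ 1 ≡ 1 × P₅ 2 ≡ 2 × P₅ 3 ≡ 4 ×
    (∀ n → 4 ≤ n →
    P₅ n ≡ 2 * H (S′ (n ∸ 1))
    + H ([ 2 ] ++ S′ (n ∸ 2))
    + ∑ [ 3 ⋯ n ∸ 2 ] (λ i → H (S′ (i ∸ 1) ++ S′ (n ∸ i))))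
-- In the small cases the sums of `sides` evaluate to 1, 1 + 1 and 1 + 2 + 1.
theorem8 = P₅≡sum-sides 0 , P₅≡sum-sides 1 , P₅≡sum-sides 2 , λ _ 4≤n → large (m≤n⇒∃[o]m+o≡n 4≤n)
  where
  large : ∀ {n} → (∃ λ q → 4 + q ≡ n) → P₅ n ≡ 2 * H (S′ (n ∸ 1)) + H ([ 2 ] ++ S′ (n ∸ 2))
    + ∑ [ 3 ⋯ n ∸ 2 ] (λ i → H (S′ (i ∸ 1) ++ S′ (n ∸ i)))
  large (q , refl) = P₅-recurrence q
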